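{- Let $G$ be a snark and let $u$ and $v$ be two distinct vertices of $G$. Then the following statements (i)–(iii) are equivalent: (i) $G-\{u,v\}$ is $3$-edge-colourable; (ii) $G-\{u,v\}$ admits a nowhere-zero $4$-flow; (iii) $G/\{u,v\}$ admits a nowhere-zero $4$-flow. If, in addition, $u$ and $v$ are adjacent and joined by an edge $e$, then statements (i)–(iii) are also equivalent to each of the following: (iv) $G-e$ admits a nowhere-zero $4$-flow; (v) $G/e$ admits a nowhere-zero $4$-flow; (vi) $G\sim e$ is $3$-edge-colourable.
   Context: Graphs may have parallel edges and loops, and occasionally dangling edges (edges with only one end-vertex). A snark is a connected cubic graph that admits no proper edge-colouring with three colours (equivalently, no nowhere-zero $4$-flow). For distinct vertices $u,v$ of $G$: $G-\{u,v\}$ denotes the graph obtained from $G$ by removing $u$ and $v$ but retaining the edges formerly incident with them as dangling edges (an edge between $u$ and $v$ disappears); $G/\{u,v\}$ denotes the graph obtained by identifying $u$ and $v$ into a single vertex. For an edge $e$: $G-e$ is the graph obtained by deleting $e$; $G/e$ is the graph obtained by contracting $e$; $G\sim e$ is the cubic graph obtained from $G-e$ by suppressing the two resulting vertices of degree two. A nowhere-zero $4$-flow on a graph (possibly with dangling edges) is an orientation together with an assignment of values from $\{\pm1,\pm2,\pm3\}$ to the edges such that Kirchhoff's law (inflow equals outflow) holds at every vertex; dangling edges are subject to no condition at their free end. -}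

module Defs where

open import Data.Nat using (ℕ; zero; suc; pred; _≤_)
open import Data.Integer using (ℤ; ∣_∣) renaming (_+_ to _+ℤ_; 0ℤ to 0ℤ)
open import Data.Fin using (Fin; zero; suc; punchOut)
open import Data.Fin.Properties using (_≟_)
open import Data.Bool using (Bool; true; false; if_then_else_)
open import Data.Maybe using (Maybe; just; nothing; _>>=_; maybe′)
open import Data.List using (List; []; _∷_; _++_; length; lookup; removeAt)
open import Data.Product using (Σ; _×_; _,_; proj₁; proj₂; ∃)
open import Data.Sum using (_⊎_)
open import Relation.Nullary using (¬_; yes; no; does)
open import Relation.Binary.PropositionalEquality using (_≡_; _≢_)
open import Relation.Binary.Construct.Closure.ReflexiveTransitive using (Star)

-- Graphs with loops, parallel edges and dangling edges.
-- Vertices are Fin n.  An edge is a pair of "ends"; an end is either a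
-- vertex (just x) or free (nothing, for a dangling edge).  Edges are the
-- positions of the list 'edges', so parallel edges are allowed.

End : ℕ → Set
End n = Maybe (Fin n)

EdgeT : ℕ → Set
EdgeT n = End n × End n

record Graph : Set where
  constructor graph
  field
    n     : ℕ
    edges : List (EdgeT n)

open Graph public

Edge : Graph → Set
Edge G = Fin (length (edges G))

endOf : (G : Graph) → Edge G → Bool → End (n G)
endOf G e false = proj₁ (lookup (edges G) e)
endOf G e true  = proj₂ (lookup (edges G) e)

sumℕ : ∀ m → (Fin m → ℕ) → ℕ
sumℕ zero    f = 0
sumℕ (suc m) f = f zero Data.Nat.+ sumℕ m (λ i → f (suc i))

sumℤ : ∀ m → (Fin m → ℤ) → ℤ
sumℤ zero    f = 0ℤ
sumℤ (suc m) f = f zero +ℤ sumℤ m (λ i → f (suc i))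

hitℕ : ∀ {n} → End n → Fin n → ℕ
hitℕ nothing  x = 0
hitℕ (just y) x = if does (y ≟ x) then 1 else 0

degree : (G : Graph) → Fin (n G) → ℕ
degree G x = sumℕ (length (edges G))
               (λ e → hitℕ (endOf G e false) x Data.Nat.+ hitℕ (endOf G e true) x)

Cubic : Graph → Set
Cubic G = (∀ (e : Edge G) (s : Bool) → Σ (Fin (n G)) λ x → endOf G e s ≡ just x)
        × (∀ (x : Fin (n G)) → degree G x ≡ 3)

Adjacent : (G : Graph) → Fin (n G) → Fin (n G) → Set
Adjacent G x y = Σ (Edge G) λ e →
  (lookup (edges G) e ≡ (just x , just y)) ⊎ (lookup (edges G) e ≡ (just y , just x))

Connected : Graph → Set
Connected G = ∀ (x y : Fin (n G)) → Star (Adjacent G) x y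

-- Proper 3-edge-colourings: two distinct edge-ends at a common vertex
-- get distinct colours (so a loop is never properly coloured);
-- free ends of dangling edges impose nothing.

ThreeEdgeColouring : (G : Graph) → (Edge G → Fin 3) → Set
ThreeEdgeColouring G c =
  ∀ (e f : Edge G) (s t : Bool) (x : Fin (n G)) →
    endOf G e s ≡ just x → endOf G f t ≡ just x → (e , s) ≢ (f , t) → c e ≢ c f

ThreeEdgeColourable : Graph → Set
ThreeEdgeColourable G = Σ (Edge G → Fin 3) (ThreeEdgeColouring G)

Snark : Graph → Set
Snark G = Connected G × Cubic G × ¬ ThreeEdgeColourable G

-- Nowhere-zero 4-flows: an orientation of every edge together with a
-- value in {±1,±2,±3}; Kirchhoff's law at every vertex.  Orientation
-- false: first end is the tail, second end the head; true: reversed.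

tailOf headOf : (G : Graph) → (Edge G → Bool) → Edge G → End (n G)
tailOf G o e = endOf G e (o e)
headOf G o e = endOf G e (if o e then false else true)

hitℤ : ∀ {n} → End n → Fin n → ℤ → ℤ
hitℤ nothing  x z = 0ℤ
hitℤ (just y) x z = if does (y ≟ x) then z else 0ℤ

NowhereZero4Flow : Graph → Set
NowhereZero4Flow G =
  Σ (Edge G → Bool) λ o → Σ (Edge G → ℤ) λ φ →
    (∀ e → (1 ≤ ∣ φ e ∣) × (∣ φ e ∣ ≤ 3)) ×
    (∀ (x : Fin (n G)) →
       sumℤ (length (edges G)) (λ e → hitℤ (headOf G o e) x (φ e))
     ≡ sumℤ (length (edges G)) (λ e → hitℤ (tailOf G o e) x (φ e)))

dropV : ∀ {k} → Fin k → Fin k → Maybe (Fin (pred k))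
dropV {suc k} u x with u ≟ x
... | yes _ = nothing
... | no p  = just (punchOut p)

punchOut′ : ∀ {k} {i j : Fin k} → i ≢ j → Fin (pred k)
punchOut′ {suc k} p = punchOut p

relabel : ∀ {n k} → (Fin n → Maybe (Fin k)) → List (EdgeT n) → List (EdgeT k)
relabel ρ [] = []
relabel ρ ((a , b) ∷ es) with a >>= ρ | b >>= ρ
... | nothing | nothing = relabel ρ es
... | a′      | b′      = (a′ , b′) ∷ relabel ρ es

-- G - {u,v}: remove u and v, keeping their edges as dangling edges
-- (an edge joining u and v disappears)
removeTwo : (G : Graph) (u v : Fin (n G)) → u ≢ v → Graph
removeTwo G u v u≢v =
  graph (pred (pred (n G)))
        (relabel (λ x → dropV u x >>= dropV (punchOut′ u≢v)) (edges G))

identify : (G : Graph) (u v : Fin (n G)) → u ≢ v → Graph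
identify G u v u≢v =
  graph (pred (n G))
        (relabel (λ x → just (maybe′ (λ y → y) (punchOut′ (λ p → u≢v (Relation.Binary.PropositionalEquality.sym p))) (dropV v x)))
                 (edges G))

deleteEdge : (G : Graph) → Edge G → Graph
deleteEdge G e = graph (n G) (removeAt (edges G) e)

Joins : (G : Graph) → Edge G → Fin (n G) → Fin (n G) → Set
Joins G e u v = (lookup (edges G) e ≡ (just u , just v)) ⊎ (lookup (edges G) e ≡ (just v , just u))

contractEdge : (G : Graph) (e : Edge G) (u v : Fin (n G)) → u ≢ v → Graph
contractEdge G e u v u≢v = identify (deleteEdge G e) u v u≢v

-- Suppression of a vertex x of degree 2.
-- The edges at x are removed and, if they are two distinct edges, replaced
-- by one edge joining their other ends; x is deleted.  If the two ends at x
-- belong to a single loop, x and the loop are removed (the resulting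
-- vertex-free circle is irrelevant to colourings and flows).

isAt : ∀ {n} → Fin n → End n → Bool
isAt x nothing  = false
isAt x (just y) = does (y ≟ x)

incident : ∀ {n} → Fin n → EdgeT n → Bool
incident x (a , b) = if isAt x a then true else isAt x b

splitAt : ∀ {n} → Fin n → List (EdgeT n) → List (EdgeT n) × List (EdgeT n)
splitAt x [] = [] , []
splitAt x (ab ∷ es) with splitAt x es
... | I , R = if incident x ab then (ab ∷ I , R) else (I , ab ∷ R)

otherEnd : ∀ {n} → Fin n → EdgeT n → End n
otherEnd x (a , b) = if isAt x a then b else a

joinEnds : ∀ {n} → Fin n → List (EdgeT n) → List (EdgeT n)
joinEnds x (f ∷ g ∷ []) = (otherEnd x f , otherEnd x g) ∷ []
joinEnds x _ = []

suppress : (G : Graph) → Fin (n G) → Graph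
suppress G x =
  graph (pred (n G))
        (relabel (dropV x) (proj₂ (splitAt x (edges G)) ++ joinEnds x (proj₁ (splitAt x (edges G)))))

smooth : (G : Graph) (e : Edge G) (u v : Fin (n G)) → u ≢ v → Graph
smooth G e u v u≢v = suppress (suppress (deleteEdge G e) u) (punchOut′ u≢v)

{-# OPTIONS --safe #-}
module Submission where

open import Defs
open import Algebra.Bundles using (CommutativeMonoid; CommutativeRing)
open import Data.Bool using (Bool; true; false; not; _∧_; _xor_; if_then_else_)
open import Data.Bool.Properties using (xor-∧-commutativeRing; ¬-not; ⇔→≡; xor-same; xor-comm; xor-identityʳ; xor-annihilates-not; not-involutive; not-distribˡ-xor; ∧-zeroʳ; ∧-identityʳ) renaming (_≟_ to _≟ᵇ_)
open import Data.Bool.Solver using (module xor-∧-Solver)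
open import Data.Fin using (Fin; zero; suc; punchIn)
open import Data.Fin.Patterns using (0F; 1F; 2F)
open import Data.Fin.Properties using (_≟_; suc-injective; all?; punchOut-injective; punchOut-punchIn; punchInᵢ≢i; punchOut-cong)
open import Data.Integer using (ℤ; +_; -[1+_]; 0ℤ; 1ℤ; ∣_∣; _⊖_) renaming (_+_ to _+ℤ_; -_ to -ℤ_; _-_ to _-ℤ_)
import Data.Integer.Properties as ℤ
open import Data.Integer.Tactic.RingSolver using (solve-∀)
open import Data.List using (List; []; _∷_; _++_; length; lookup; removeAt)
open import Data.List.Membership.Propositional.Properties using (∈-lookup)
open import Data.List.Properties using (length-++; ++-assoc)
open import Data.List.Relation.Binary.Permutation.Propositional as ↭ using (_↭_; ↭-sym; ↭-reflexive)
import Data.List.Relation.Binary.Permutation.Propositional.Properties as ↭ₚ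
open import Data.List.Relation.Unary.All as All using (All; []; _∷_)
open import Data.List.Relation.Unary.All.Properties using () renaming (++⁺ to All-++⁺; ++⁻ˡ to All-++⁻ˡ; ++⁻ʳ to All-++⁻ʳ)
open import Data.List.Relation.Unary.AllPairs using (AllPairs; []; _∷_)
open import Data.Maybe using (Maybe; just; nothing; _>>=_; maybe′)
open import Data.Maybe.Properties using (just-injective; ≡-dec)
open import Data.Nat using (ℕ; zero; suc; pred; _+_; _≤_; s≤s; z≤n)
open import Data.Nat.Properties using (+-assoc) renaming (suc-injective to suc-injectiveℕ)
open import Data.Product using (Σ; _×_; _,_; proj₁; proj₂)
open import Data.Sum as Sum using (_⊎_; inj₁; inj₂)
open import Data.Unit using (tt)
open import Data.Vec.Functional using (updateAt) renaming (_∷_ to _◂_)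
open import Data.Vec.Functional.Properties using (updateAt-updates; updateAt-minimal)
open import Function using (_∘_; const)
open import Function.Bundles using (_⇔_; mk⇔; Equivalence)
import Function.Properties.Equivalence as ⇔
open import Relation.Binary.PropositionalEquality using (_≡_; _≢_; _≗_; refl; sym; trans; cong; cong₂; subst; ≢-sym; module ≡-Reasoning)
open import Relation.Nullary using (¬_; yes; no; does; contradiction)
open import Relation.Nullary.Decidable using (toWitness; _→-dec_; _×-dec_; ¬?; dec-true; dec-false)

-- Call a labelling of the edges by the nonzero elements of ℤ₂ × ℤ₂ whose sum vanishes at every
-- vertex a Klein flow. An even subgraph has an orientation balanced at every vertex (split off
-- pairs of edges), and this gives the equivalence of nowhere-zero 4-flows and Klein flows: two even
-- subgraphs oriented as flows t₀, t₁ yield t₀ + 2t₁, and conversely one subtracts from ψ the flow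
-- t on its odd edges and halves. At vertices of degree 3 a Klein flow is a proper 3-edge-colouring.
-- So all statements concern Klein flows. Since the sums at all vertices add up to zero, a
-- labelling conserved away from u and v has equal excess at u and v; this handles G/{u,v}, and
-- it handles G - e because a nonzero common excess, put on e, would colour the snark G.

-- In the flow equivalence the obstacle is the passage from ℤ₂ to ℤ: an even set of edges carries no
-- signs, and signs chosen edge by edge need not balance. Hence the balanced orientation, which
-- lifts an even set to an integer flow with values 0 and ±1 and the same support. The graph
-- operations raise another difficulty: each of them yields a new edge list, so labellings before
-- and after have different index types. They are compared through `at w E c`, the list of labels at
-- the edge-ends selected by `w`, taken up to permutation. Its `parity` expresses conservation, its
-- `length` the degree, and pairwise distinctness of its entries properness. One correspondence of
-- labellings, valid for all suitable `w` at once, therefore transfers flows and degrees together.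

module SumChange {a ℓ} (M : CommutativeMonoid a ℓ) where
  open CommutativeMonoid M hiding (sym; trans) renaming (refl to ≈-refl)
  open import Algebra.Properties.CommutativeMonoid.Sum M
  open import Algebra.Solver.CommutativeMonoid M using (solve; _⊕_; _⊜_)
  open import Relation.Binary.Reasoning.Setoid setoid

  -- The subtraction-free form of replacing one summand: it needs no inverses, so one proof serves
  -- both ℤ₂ and ℤ.
  sum-change : ∀ {m} (i : Fin m) (f g : Fin m → Carrier) →
               (∀ j → j ≢ i → f j ≈ g j) → sum f ∙ g i ≈ sum g ∙ f i
  sum-change zero f g h = begin
    (f zero ∙ sum (f ∘ suc)) ∙ g zero
      ≈⟨ ∙-congʳ (∙-congˡ (sum-cong-≋ (λ j → h (suc j) λ ()))) ⟩
    (f zero ∙ sum (g ∘ suc)) ∙ g zero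
      ≈⟨ solve 3 (λ x y z → (x ⊕ y) ⊕ z ⊜ (z ⊕ y) ⊕ x) ≈-refl (f zero) _ (g zero) ⟩
    (g zero ∙ sum (g ∘ suc)) ∙ f zero ∎
  sum-change (suc i) f g h = begin
    (f zero ∙ sum (f ∘ suc)) ∙ g (suc i) ≈⟨ assoc _ _ _ ⟩
    f zero ∙ (sum (f ∘ suc) ∙ g (suc i))
      ≈⟨ ∙-cong (h zero λ ()) (sum-change i (f ∘ suc) (g ∘ suc) λ j j≢i → h (suc j) (j≢i ∘ suc-injective)) ⟩
    g zero ∙ (sum (g ∘ suc) ∙ f (suc i)) ≈⟨ assoc _ _ _ ⟨
    (g zero ∙ sum (g ∘ suc)) ∙ f (suc i) ∎

xor-commutativeMonoid : CommutativeMonoid _ _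
xor-commutativeMonoid = CommutativeRing.+-commutativeMonoid xor-∧-commutativeRing

module ⊕ where
  open import Algebra.Properties.CommutativeMonoid.Sum xor-commutativeMonoid public
  open SumChange xor-commutativeMonoid public

module ℤ+ where
  open import Algebra.Properties.CommutativeMonoid.Sum ℤ.+-0-commutativeMonoid public
  open SumChange ℤ.+-0-commutativeMonoid public

private variable
  N K m : ℕ
  A : Set
  P : A → Set

-- Cuts modulo 2 and net flow into a vertex

crosses : (End N → Bool) → EdgeT N → Bool
crosses w (a , b) = w a xor w b

-- For `w = isAt x` this is the degree parity of the marked edges at `x`, where a loop cancels
-- itself; for a larger set of vertices it is the parity of a cut.
cutParity : (End N → Bool) → (Fin m → EdgeT N) → (Fin m → Bool) → Bool
cutParity w E β = ⊕.sum (λ e → β e ∧ crosses w (E e))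

isAt-self : (x : Fin N) → isAt x (just x) ≡ true
isAt-self x = dec-true (x ≟ x) refl

isAt-other : {x y : Fin N} → y ≢ x → isAt x (just y) ≡ false
isAt-other {x = x} {y} y≢x = dec-false (y ≟ x) y≢x

isAt⇒≡ : (x : Fin N) (a : End N) → isAt x a ≡ true → a ≡ just x
isAt⇒≡ x (just y) p with y ≟ x
... | yes refl = refl
isAt⇒≡ x (just y) () | no _

end : EdgeT N → Bool → End N
end ab false = proj₁ ab
end ab true  = proj₂ ab

inflow : Fin N → EdgeT N → ℤ → ℤ
inflow x (a , b) z = hitℤ b x z -ℤ hitℤ a x z

net : Fin N → (Fin m → EdgeT N) → (Fin m → ℤ) → ℤ
net x E ψ = ℤ+.sum (λ e → inflow x (E e) (ψ e))

hitℤ-isAt : (a : End N) (x : Fin N) (z : ℤ) → hitℤ a x z ≡ (if isAt x a then z else 0ℤ)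
hitℤ-isAt nothing  x z = refl
hitℤ-isAt (just y) x z = refl

hitℤ-zero : (a : End N) (x : Fin N) → hitℤ a x 0ℤ ≡ 0ℤ
hitℤ-zero a x rewrite hitℤ-isAt a x 0ℤ with isAt x a
... | true  = refl
... | false = refl

hitℤ-+ : (a : End N) (x : Fin N) (y z : ℤ) → hitℤ a x (y +ℤ z) ≡ hitℤ a x y +ℤ hitℤ a x z
hitℤ-+ a x y z rewrite hitℤ-isAt a x (y +ℤ z) | hitℤ-isAt a x y | hitℤ-isAt a x z with isAt x a
... | true  = refl
... | false = refl

hitℤ-neg : (a : End N) (x : Fin N) (z : ℤ) → hitℤ a x (-ℤ z) ≡ -ℤ hitℤ a x z
hitℤ-neg a x z rewrite hitℤ-isAt a x (-ℤ z) | hitℤ-isAt a x z with isAt x a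
... | true  = refl
... | false = refl

inflow-zero : (x : Fin N) (ab : EdgeT N) → inflow x ab 0ℤ ≡ 0ℤ
inflow-zero x (a , b) rewrite hitℤ-zero a x | hitℤ-zero b x = refl

inflow-+ : (x : Fin N) (ab : EdgeT N) (y z : ℤ) →
           inflow x ab (y +ℤ z) ≡ inflow x ab y +ℤ inflow x ab z
inflow-+ x (a , b) y z rewrite hitℤ-+ a x y z | hitℤ-+ b x y z =
  rearrange (hitℤ b x y) (hitℤ b x z) (hitℤ a x y) (hitℤ a x z)
  where
  rearrange : ∀ p q r s → (p +ℤ q) -ℤ (r +ℤ s) ≡ (p -ℤ r) +ℤ (q -ℤ s)
  rearrange = solve-∀

net-+ : (x : Fin N) (E : Fin m → EdgeT N) (ψ χ : Fin m → ℤ) →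
        net x E (λ e → ψ e +ℤ χ e) ≡ net x E ψ +ℤ net x E χ
net-+ x E ψ χ = trans (ℤ+.sum-cong-≗ (λ e → inflow-+ x (E e) (ψ e) (χ e)))
                      (ℤ+.∑-distrib-+ (λ e → inflow x (E e) (ψ e)) (λ e → inflow x (E e) (χ e)))

-- The balanced orientation of an even subgraph

unit : Bool → ℤ
unit true  = 1ℤ
unit false = -ℤ 1ℤ

unit-not : ∀ s → unit (not s) ≡ -ℤ unit s
unit-not true  = refl
unit-not false = refl

signed : Bool → Bool → ℤ
signed β s = if β then unit s else 0ℤ

Balanced : (Fin m → EdgeT N) → (Fin m → Bool) → (Fin m → Bool) → Set
Balanced E β s = ∀ x → net x E (λ e → signed (β e) (s e)) ≡ 0ℤ

Even : (Fin m → EdgeT N) → (Fin m → Bool) → Set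
Even E β = ∀ x → cutParity (isAt x) E β ≡ false

directed : Bool → End N → End N → EdgeT N
directed false a b = a , b
directed true  a b = b , a

-- Reversing the stored order of the ends and negating the value cancel; `σ xor s` negates exactly
-- when the order is reversed.
inflow-directed : ∀ (x : Fin N) σ a b s →
  inflow x (directed σ a b) (unit (σ xor s)) ≡ inflow x (a , b) (unit s)
inflow-directed x false a b s = refl
inflow-directed x true  a b s rewrite unit-not s | hitℤ-neg a x (unit s) | hitℤ-neg b x (unit s) =
  rearrange (hitℤ a x (unit s)) (hitℤ b x (unit s))
  where
  rearrange : ∀ p q → -ℤ p -ℤ -ℤ q ≡ q -ℤ p
  rearrange = solve-∀

crosses-directed : ∀ (w : End N → Bool) σ a b → crosses w (directed σ a b) ≡ w a xor w b
crosses-directed w false a b = refl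
crosses-directed w true  a b = xor-comm (w b) (w a)

odd-sum⇒true : (f : Fin m → Bool) → ⊕.sum f ≡ true → Σ (Fin m) λ i → f i ≡ true
odd-sum⇒true {suc m} f p with f zero in f₀
... | true  = zero , f₀
... | false with odd-sum⇒true (f ∘ suc) p
...   | i , fᵢ = suc i , fᵢ

end-at : (x : Fin N) (ab : EdgeT N) → crosses (isAt x) ab ≡ true →
         Σ Bool λ τ → Σ (End N) λ d → ab ≡ directed τ (just x) d
end-at x (a , b) p with isAt x a in xa
... | true = false , b , cong (_, b) (isAt⇒≡ x a xa)
... | false = true , a , cong (a ,_) (isAt⇒≡ x b p)

-- Induction on the number of edges. An unmarked edge, or one whose two ends coincide, is skipped.
-- Any other marked edge has an end at a vertex `x`, where evenness supplies a second marked edge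
-- with which to split it off.
balance : (E : Fin m → EdgeT N) (β : Fin m → Bool) → Even E β → Σ (Fin m → Bool) (Balanced E β)

-- Splitting off: the edges  b — x — d  are replaced by one edge  b — d,
-- whose orientation is then used for both.
splitOff : (E : Fin (suc m) → EdgeT N) (β : Fin (suc m) → Bool) → Even E β → β zero ≡ true →
           ∀ σ x b → E zero ≡ directed σ (just x) b → b ≢ just x →
           Σ (Fin (suc m) → Bool) (Balanced E β)
splitOff {m} {N} E β even β₀ σ x b E₀ b≢x = s , balanced
  where
  open ≡-Reasoning

  crosses₀ : ∀ w → crosses w (E zero) ≡ w (just x) xor w b
  crosses₀ w = trans (cong (crosses w) E₀) (crosses-directed w σ (just x) b)

  b-off : isAt x b ≡ false
  b-off with isAt x b in xb
  ... | true  = contradiction (isAt⇒≡ x b xb) b≢x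
  ... | false = refl

  -- Evenness makes the remaining marked edges carry the same parity as edge `zero`. At `x` this
  -- parity is odd because `b ≢ just x`, so one of them crosses `x`.
  rest : ∀ y → ⊕.sum (λ e → β (suc e) ∧ crosses (isAt y) (E (suc e))) ≡ isAt y (just x) xor isAt y b
  rest y = begin
    R                                ≡⟨ solve 2 (λ r c → r := c :+ (c :+ r)) refl R C ⟩
    C xor (C xor R)                  ≡⟨ cong (λ t → C xor ((t ∧ C) xor R)) β₀ ⟨
    C xor ((β zero ∧ C) xor R)       ≡⟨ cong (C xor_) (even y) ⟩
    C xor false                      ≡⟨ xor-identityʳ C ⟩
    C                                ≡⟨ crosses₀ (isAt y) ⟩
    isAt y (just x) xor isAt y b     ∎
    where
    open xor-∧-Solver
    C = crosses (isAt y) (E zero)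
    R = ⊕.sum (λ e → β (suc e) ∧ crosses (isAt y) (E (suc e)))

  found : Σ (Fin m) λ i → (β (suc i) ∧ crosses (isAt x) (E (suc i))) ≡ true
  found = odd-sum⇒true _ (trans (rest x) (cong₂ _xor_ (isAt-self x) b-off))

  i : Fin m
  i = proj₁ found

  ∧-true : ∀ {p q} → p ∧ q ≡ true → p ≡ true × q ≡ true
  ∧-true {true} {true} _ = refl , refl

  βᵢ : β (suc i) ≡ true
  βᵢ = proj₁ (∧-true (proj₂ found))

  other : Σ Bool λ τ → Σ (End N) λ d → E (suc i) ≡ directed τ (just x) d
  other = end-at x (E (suc i)) (proj₂ (∧-true (proj₂ found)))

  τ : Bool
  τ = proj₁ other

  d : End N
  d = proj₁ (proj₂ other)

  -- The new edge may be a loop or have two free ends; the recursive call then skips it.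
  E′ : Fin m → EdgeT N
  E′ = updateAt (E ∘ suc) i (const (b , d))

  E′ᵢ : E′ i ≡ (b , d)
  E′ᵢ = updateAt-updates i (E ∘ suc)

  even′ : Even E′ (β ∘ suc)
  even′ y = begin
    ⊕.sum g                                ≡⟨ solve 2 (λ s t → s := (s :+ t) :+ t) refl (⊕.sum g) (f i) ⟩
    (⊕.sum g xor f i) xor f i              ≡⟨ cong (_xor f i) (⊕.sum-change i g f agree) ⟩
    (⊕.sum f xor g i) xor f i              ≡⟨ cong₂ (λ p q → (p xor g i) xor q) (rest y) fᵢ ⟩
    ((X xor B) xor g i) xor (X xor D)      ≡⟨ cong (λ p → ((X xor B) xor p) xor (X xor D)) gᵢ ⟩
    ((X xor B) xor (B xor D)) xor (X xor D) ≡⟨ solve 3 (λ X B D → ((X :+ B) :+ (B :+ D)) :+ (X :+ D) := con false) refl X B D ⟩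
    false ∎
    where
    open xor-∧-Solver
    X = isAt y (just x)
    B = isAt y b
    D = isAt y d
    f g : Fin m → Bool
    f e = β (suc e) ∧ crosses (isAt y) (E (suc e))
    g e = β (suc e) ∧ crosses (isAt y) (E′ e)
    agree : ∀ j → j ≢ i → g j ≡ f j
    agree j j≢i = cong (λ ab → β (suc j) ∧ crosses (isAt y) ab) (updateAt-minimal j i (E ∘ suc) j≢i)
    fᵢ : f i ≡ X xor D
    fᵢ = trans (cong₂ (λ p q → p ∧ crosses (isAt y) q) βᵢ (proj₂ (proj₂ other)))
               (crosses-directed (isAt y) τ (just x) d)
    gᵢ : g i ≡ B xor D
    gᵢ = cong₂ (λ p q → p ∧ crosses (isAt y) q) βᵢ E′ᵢ

  ih : Σ (Fin m → Bool) (Balanced E′ (β ∘ suc))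
  ih = balance E′ (β ∘ suc) even′

  s′ : Fin m → Bool
  s′ = proj₁ ih

  t : Bool
  t = s′ i

  -- The path through `x` follows the direction `t` of the edge from `b` to `d`. Its first half is
  -- read from `x` to `b`, against the path, and gets `not t`; the second, read from `x` to `d`,
  -- gets `t`. `σ` and `τ` correct for the stored order of the ends.
  s : Fin (suc m) → Bool
  s = (σ xor not t) ◂ updateAt s′ i (τ xor_)

  balanced : Balanced E β s
  balanced y = begin
    F zero +ℤ ℤ+.sum f                       ≡⟨ shuffle (F zero) (ℤ+.sum f) (g i) ⟩
    (F zero +ℤ (ℤ+.sum f +ℤ g i)) -ℤ g i     ≡⟨ cong (λ p → (F zero +ℤ p) -ℤ g i) (ℤ+.sum-change i f g agree) ⟩
    (F zero +ℤ (ℤ+.sum g +ℤ f i)) -ℤ g i     ≡⟨ cong (λ p → (F zero +ℤ (p +ℤ f i)) -ℤ g i) (proj₂ ih y) ⟩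
    (F zero +ℤ (0ℤ +ℤ f i)) -ℤ g i           ≡⟨ cong₂ (λ p q → (p +ℤ (0ℤ +ℤ q)) -ℤ g i) F₀ fᵢ ⟩
    ((-ℤ B -ℤ -ℤ X) +ℤ (0ℤ +ℤ (D -ℤ X))) -ℤ g i ≡⟨ cong (λ p → ((-ℤ B -ℤ -ℤ X) +ℤ (0ℤ +ℤ (D -ℤ X))) -ℤ p) gᵢ ⟩
    ((-ℤ B -ℤ -ℤ X) +ℤ (0ℤ +ℤ (D -ℤ X))) -ℤ (D -ℤ B) ≡⟨ cancel X B D ⟩
    0ℤ ∎
    where
    X = hitℤ (just x) y (unit t)
    B = hitℤ b y (unit t)
    D = hitℤ d y (unit t)
    F : Fin (suc m) → ℤ
    F e = inflow y (E e) (signed (β e) (s e))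
    f g : Fin m → ℤ
    f = F ∘ suc
    g e = inflow y (E′ e) (signed (β (suc e)) (s′ e))
    shuffle : ∀ p q r → p +ℤ q ≡ (p +ℤ (q +ℤ r)) -ℤ r
    shuffle = solve-∀
    cancel : ∀ X B D → ((-ℤ B -ℤ -ℤ X) +ℤ (0ℤ +ℤ (D -ℤ X))) -ℤ (D -ℤ B) ≡ 0ℤ
    cancel = solve-∀
    agree : ∀ j → j ≢ i → f j ≡ g j
    agree j j≢i = cong₂ (λ ab z → inflow y ab (signed (β (suc j)) z))
                        (sym (updateAt-minimal j i (E ∘ suc) j≢i)) (updateAt-minimal j i s′ j≢i)
    F₀ : F zero ≡ -ℤ B -ℤ -ℤ X
    F₀ = trans (cong₂ (λ ab p → inflow y ab (signed p (σ xor not t))) E₀ β₀)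
        (trans (inflow-directed y σ (just x) b (not t))
        (trans (cong (λ z → hitℤ b y z -ℤ hitℤ (just x) y z) (unit-not t))
               (cong₂ _-ℤ_ (hitℤ-neg b y (unit t)) (hitℤ-neg (just x) y (unit t)))))
    fᵢ : f i ≡ D -ℤ X
    fᵢ = trans (cong₂ (λ ab p → inflow y ab (signed p (updateAt s′ i (τ xor_) i))) (proj₂ (proj₂ other)) βᵢ)
        (trans (cong (λ z → inflow y (directed τ (just x) d) (unit z)) (updateAt-updates i s′))
               (inflow-directed y τ (just x) d t))
    gᵢ : g i ≡ D -ℤ B
    gᵢ = cong₂ (λ ab p → inflow y ab (signed p t)) E′ᵢ βᵢ

-- Such an edge affects neither the parities nor the net flows, so the direction `true` is an
-- arbitrary choice.
skip : (E : Fin (suc m) → EdgeT N) (β : Fin (suc m) → Bool) → Even E β →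
       (∀ x → β zero ∧ crosses (isAt x) (E zero) ≡ false) →
       (∀ x → inflow x (E zero) (signed (β zero) true) ≡ 0ℤ) →
       Σ (Fin (suc m) → Bool) (Balanced E β)
skip E β even uncrossed inert with balance (E ∘ suc) (β ∘ suc)
    (λ x → trans (cong (_xor ⊕.sum (λ e → β (suc e) ∧ crosses (isAt x) (E (suc e)))) (sym (uncrossed x))) (even x))
... | s , balanced = true ◂ s , λ x → cong₂ _+ℤ_ (inert x) (balanced x)

orientable : (ab : EdgeT N) → proj₁ ab ≢ proj₂ ab →
             Σ Bool λ σ → Σ (Fin N) λ x → Σ (End N) λ b → ab ≡ directed σ (just x) b × b ≢ just x
orientable (just x  , b)       a≢b = false , x , b , refl , a≢b ∘ sym
orientable (nothing , just y)  a≢b = true , y , nothing , refl , a≢b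
orientable (nothing , nothing) a≢b = contradiction refl a≢b

balance {zero} E β even = (λ ()) , λ x → refl
balance {suc m} E β even with β zero ≟ᵇ false | ≡-dec _≟_ (proj₁ (E zero)) (proj₂ (E zero))
... | yes β₀ | _ = skip E β even
      (λ x → cong (_∧ crosses (isAt x) (E zero)) β₀)
      (λ x → trans (cong (λ p → inflow x (E zero) (signed p true)) β₀) (inflow-zero x (E zero)))
... | no _  | yes a≡b = skip E β even
      (λ x → trans (cong (λ a → β zero ∧ (isAt x a xor isAt x (proj₂ (E zero)))) a≡b)
             (trans (cong (β zero ∧_) (xor-same (isAt x (proj₂ (E zero))))) (∧-zeroʳ (β zero))))
      (λ x → trans (cong (λ a → hitℤ (proj₂ (E zero)) x (signed (β zero) true) -ℤ hitℤ a x (signed (β zero) true)) a≡b)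
                   (ℤ.+-inverseʳ (hitℤ (proj₂ (E zero)) x (signed (β zero) true))))
... | no β₀ | no a≢b with orientable (E zero) a≢b
...   | σ , x , b , E₀ , b≢x = splitOff E β even (¬-not β₀) σ x b E₀ b≢x

-- Klein flows

hits : Bool → A → List A
hits true  k = k ∷ []
hits false k = []

at : (End N → Bool) → (Fin m → EdgeT N) → (Fin m → A) → List A
at {m = zero}  w E c = []
at {m = suc m} w E c =
  hits (w (proj₁ (E zero))) (c zero) ++ hits (w (proj₂ (E zero))) (c zero) ++ at w (E ∘ suc) (c ∘ suc)

parity : (A → Bool) → List A → Bool
parity f []       = false
parity f (k ∷ ks) = f k xor parity f ks

-- The three colours as the nonzero elements of ℤ₂ × ℤ₂.
bit : Bool → Fin 3 → Bool
bit false 0F = true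
bit false 1F = false
bit false 2F = true
bit true  0F = false
bit true  1F = true
bit true  2F = true

Conserved : (Fin m → EdgeT N) → (Fin m → Fin 3) → (End N → Bool) → Set
Conserved E c w = ∀ i → parity (bit i) (at w E c) ≡ false

KleinFlow : List (EdgeT N) → Set
KleinFlow es = Σ (Fin (length es) → Fin 3) λ c → ∀ x → Conserved (lookup es) c (isAt x)

-- The left side sums over edge-ends, the right side over edges; they agree because an edge with
-- both ends selected counts its label twice, which is zero modulo 2.
parity-at : (f : A → Bool) (w : End N → Bool) (E : Fin m → EdgeT N) (c : Fin m → A) →
            parity f (at w E c) ≡ cutParity w E (f ∘ c)
parity-at {m = zero} f w E c = refl
parity-at {m = suc m} f w E c =
  trans (edge (w (proj₁ (E zero))) (w (proj₂ (E zero))) (c zero) _)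
        (cong ((f (c zero) ∧ crosses w (E zero)) xor_) (parity-at f w (E ∘ suc) (c ∘ suc)))
  where
  edge : ∀ p q k ks → parity f (hits p k ++ hits q k ++ ks) ≡ (f k ∧ (p xor q)) xor parity f ks
  edge p q k ks with f k in fk
  edge true  true  k ks | true  rewrite fk = not-involutive _
  edge true  true  k ks | false rewrite fk = refl
  edge true  false k ks | true  rewrite fk = refl
  edge true  false k ks | false rewrite fk = refl
  edge false true  k ks | true  rewrite fk = refl
  edge false true  k ks | false rewrite fk = refl
  edge false false k ks | true  = refl
  edge false false k ks | false = refl

-- Integer flows with the orientation absorbed into the signs

SignedFlow : List (EdgeT N) → Set
SignedFlow es = Σ (Fin (length es) → ℤ) λ ψ →
  (∀ e → (1 ≤ ∣ ψ e ∣) × (∣ ψ e ∣ ≤ 3)) × (∀ x → net x (lookup es) ψ ≡ 0ℤ)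

sumℤ-∸ : ∀ m (f g : Fin m → ℤ) → ℤ+.sum (λ e → f e -ℤ g e) ≡ sumℤ m f -ℤ sumℤ m g
sumℤ-∸ zero f g = refl
sumℤ-∸ (suc m) f g = trans (cong ((f zero -ℤ g zero) +ℤ_) (sumℤ-∸ m (f ∘ suc) (g ∘ suc)))
                           (rearrange (f zero) (g zero) (sumℤ m (f ∘ suc)) (sumℤ m (g ∘ suc)))
  where
  rearrange : ∀ p q r s → (p -ℤ q) +ℤ (r -ℤ s) ≡ (p +ℤ r) -ℤ (q +ℤ s)
  rearrange = solve-∀

nowhereZero4Flow⇔signedFlow : (G : Graph) → NowhereZero4Flow G ⇔ SignedFlow (edges G)
nowhereZero4Flow⇔signedFlow G = mk⇔ to from
  where
  size : ℕ
  size = length (edges G)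

  to : NowhereZero4Flow G → SignedFlow (edges G)
  to (o , φ , bounded , kirchhoff) = ψ , boundedψ , λ x → begin
    net x (lookup (edges G)) ψ
      ≡⟨ ℤ+.sum-cong-≗ (reorient x) ⟩
    ℤ+.sum (λ e → hitℤ (headOf G o e) x (φ e) -ℤ hitℤ (tailOf G o e) x (φ e))
      ≡⟨ sumℤ-∸ size _ _ ⟩
    sumℤ size (λ e → hitℤ (headOf G o e) x (φ e)) -ℤ sumℤ size (λ e → hitℤ (tailOf G o e) x (φ e))
      ≡⟨ ℤ.i≡j⇒i-j≡0 (kirchhoff x) ⟩
    0ℤ ∎
    where
    open ≡-Reasoning
    ψ : Edge G → ℤ
    ψ e = if o e then -ℤ φ e else φ e
    boundedψ : ∀ e → (1 ≤ ∣ ψ e ∣) × (∣ ψ e ∣ ≤ 3)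
    boundedψ e with o e
    ... | false = bounded e
    ... | true  = subst (λ k → (1 ≤ k) × (k ≤ 3)) (sym (ℤ.∣-i∣≡∣i∣ (φ e))) (bounded e)
    neg-swap : ∀ p q → -ℤ p -ℤ -ℤ q ≡ q -ℤ p
    neg-swap = solve-∀
    reorient : ∀ x e → inflow x (lookup (edges G) e) (ψ e)
                       ≡ hitℤ (headOf G o e) x (φ e) -ℤ hitℤ (tailOf G o e) x (φ e)
    reorient x e with o e
    ... | false = refl
    ... | true  = trans (cong₂ _-ℤ_ (hitℤ-neg (endOf G e true) x (φ e)) (hitℤ-neg (endOf G e false) x (φ e)))
                        (neg-swap (hitℤ (endOf G e true) x (φ e)) (hitℤ (endOf G e false) x (φ e)))

  from : SignedFlow (edges G) → NowhereZero4Flow G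
  from (ψ , bounded , balanced) = const false , ψ , bounded , λ x →
    ℤ.i-j≡0⇒i≡j _ _ (trans (sym (sumℤ-∸ size _ _)) (balanced x))

-- Reduction of integer flows modulo 2, and the equivalence with Klein flows

oddℕ : ℕ → Bool
oddℕ zero    = false
oddℕ (suc k) = not (oddℕ k)

odd : ℤ → Bool
odd z = oddℕ ∣ z ∣

oddℕ-+ : ∀ j k → oddℕ (j + k) ≡ oddℕ j xor oddℕ k
oddℕ-+ zero    k = refl
oddℕ-+ (suc j) k = trans (cong not (oddℕ-+ j k)) (not-distribˡ-xor (oddℕ j) (oddℕ k))

odd-⊖ : ∀ j k → odd (j ⊖ k) ≡ oddℕ j xor oddℕ k
odd-⊖ zero    zero    = refl
odd-⊖ zero    (suc k) = refl
odd-⊖ (suc j) zero    = sym (xor-identityʳ _)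
odd-⊖ (suc j) (suc k) rewrite ℤ.[1+m]⊖[1+n]≡m⊖n j k | odd-⊖ j k with oddℕ j | oddℕ k
... | false | false = refl
... | false | true  = refl
... | true  | false = refl
... | true  | true  = refl

odd-+ : ∀ y z → odd (y +ℤ z) ≡ odd y xor odd z
odd-+ (+ j)    (+ k)    = oddℕ-+ j k
odd-+ (+ j)    -[1+ k ] = odd-⊖ j (suc k)
odd-+ -[1+ j ] (+ k)    = trans (odd-⊖ k (suc j)) (xor-comm (oddℕ k) (oddℕ (suc j)))
odd-+ -[1+ j ] -[1+ k ] rewrite oddℕ-+ j k with oddℕ j | oddℕ k
... | false | false = refl
... | false | true  = refl
... | true  | false = refl
... | true  | true  = refl

odd-inflow : (x : Fin N) (ab : EdgeT N) (z : ℤ) → odd (inflow x ab z) ≡ odd z ∧ crosses (isAt x) ab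
odd-inflow x (a , b) z
  rewrite hitℤ-isAt a x z | hitℤ-isAt b x z
        | odd-+ (if isAt x b then z else 0ℤ) (-ℤ (if isAt x a then z else 0ℤ))
        | ℤ.∣-i∣≡∣i∣ (if isAt x a then z else 0ℤ) with isAt x a | isAt x b | odd z in oz
... | false | false | false = refl
... | false | false | true  = refl
... | false | true  | false rewrite oz = refl
... | false | true  | true  rewrite oz = refl
... | true  | false | false rewrite oz = refl
... | true  | false | true  rewrite oz = refl
... | true  | true  | false rewrite oz = refl
... | true  | true  | true  rewrite oz = refl

odd-net : (x : Fin N) (E : Fin m → EdgeT N) (ψ : Fin m → ℤ) →
          odd (net x E ψ) ≡ cutParity (isAt x) E (odd ∘ ψ)
odd-net {m = zero}  x E ψ = refl
odd-net {m = suc m} x E ψ =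
  trans (odd-+ (inflow x (E zero) (ψ zero)) (net x (E ∘ suc) (ψ ∘ suc)))
        (cong₂ _xor_ (odd-inflow x (E zero) (ψ zero)) (odd-net x (E ∘ suc) (ψ ∘ suc)))

double-zero : ∀ z → z +ℤ z ≡ 0ℤ → z ≡ 0ℤ
double-zero (+ zero) p = refl

-- Writing a flow value as  ψ = t + 2h  with  t ∈ {0, ±1}  of the parity of ψ and of prescribed
-- sign, the parities of ψ and h are the two coordinates of a nonzero element of ℤ₂ × ℤ₂.
halve : ∀ ψ → 1 ≤ ∣ ψ ∣ → ∣ ψ ∣ ≤ 3 → ∀ s →
        Σ ℤ λ h → Σ (Fin 3) λ k →
          (ψ ≡ signed (odd ψ) s +ℤ (h +ℤ h)) × (bit false k ≡ odd ψ) × (bit true k ≡ odd h)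
halve (+ 1)    _ _ true  = + 0 , 0F , refl , refl , refl
halve (+ 1)    _ _ false = + 1 , 2F , refl , refl , refl
halve (+ 2)    _ _ s     = + 1 , 1F , refl , refl , refl
halve (+ 3)    _ _ true  = + 1 , 2F , refl , refl , refl
halve (+ 3)    _ _ false = + 2 , 0F , refl , refl , refl
halve (+ suc (suc (suc (suc _)))) _ (s≤s (s≤s (s≤s ()))) _
halve -[1+ 0 ] _ _ true  = -[1+ 0 ] , 2F , refl , refl , refl
halve -[1+ 0 ] _ _ false = + 0 , 0F , refl , refl , refl
halve -[1+ 1 ] _ _ s     = -[1+ 0 ] , 1F , refl , refl , refl
halve -[1+ 2 ] _ _ true  = -[1+ 1 ] , 0F , refl , refl , refl
halve -[1+ 2 ] _ _ false = -[1+ 0 ] , 2F , refl , refl , refl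
halve -[1+ suc (suc (suc _)) ] _ (s≤s (s≤s (s≤s ()))) _

-- The half `h` is conserved because twice its net flow is that of `ψ` minus that of `t`, both zero,
-- and ℤ has no 2-torsion. The bounds on `ψ` leave ±2 as its only even values; there `h` is odd, so
-- the two parities never vanish together.
signedFlow⇒kleinFlow : (es : List (EdgeT N)) → SignedFlow es → KleinFlow es
signedFlow⇒kleinFlow es (ψ , bounded , balanced) = c , conserved
  where
  open ≡-Reasoning
  E = lookup es

  evenψ : Even E (odd ∘ ψ)
  evenψ x = trans (sym (odd-net x E ψ)) (cong odd (balanced x))

  s = proj₁ (balance E (odd ∘ ψ) evenψ)
  split = λ e → halve (ψ e) (proj₁ (bounded e)) (proj₂ (bounded e)) (s e)
  h = λ e → proj₁ (split e)
  c = λ e → proj₁ (proj₂ (split e))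
  t = λ e → signed (odd (ψ e)) (s e)

  net-h : ∀ x → net x E h ≡ 0ℤ
  net-h x = double-zero (net x E h) (begin
    net x E h +ℤ net x E h
      ≡⟨ net-+ x E h h ⟨
    net x E (λ e → h e +ℤ h e)
      ≡⟨ ℤ.+-identityˡ _ ⟨
    0ℤ +ℤ net x E (λ e → h e +ℤ h e)
      ≡⟨ cong (_+ℤ net x E (λ e → h e +ℤ h e)) (proj₂ (balance E (odd ∘ ψ) evenψ) x) ⟨
    net x E t +ℤ net x E (λ e → h e +ℤ h e)
      ≡⟨ net-+ x E t (λ e → h e +ℤ h e) ⟨
    net x E (λ e → t e +ℤ (h e +ℤ h e))
      ≡⟨ ℤ+.sum-cong-≗ (λ e → cong (inflow x (E e)) (proj₁ (proj₂ (proj₂ (split e))))) ⟨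
    net x E ψ
      ≡⟨ balanced x ⟩
    0ℤ ∎)

  conserved : ∀ x → Conserved E c (isAt x)
  conserved x false = begin
    parity (bit false) (at (isAt x) E c)      ≡⟨ parity-at (bit false) (isAt x) E c ⟩
    cutParity (isAt x) E (bit false ∘ c)      ≡⟨ ⊕.sum-cong-≗ (λ e → cong (_∧ crosses (isAt x) (E e)) (proj₁ (proj₂ (proj₂ (proj₂ (split e)))))) ⟩
    cutParity (isAt x) E (odd ∘ ψ)            ≡⟨ evenψ x ⟩
    false ∎
  conserved x true = begin
    parity (bit true) (at (isAt x) E c)       ≡⟨ parity-at (bit true) (isAt x) E c ⟩
    cutParity (isAt x) E (bit true ∘ c)       ≡⟨ ⊕.sum-cong-≗ (λ e → cong (_∧ crosses (isAt x) (E e)) (proj₂ (proj₂ (proj₂ (proj₂ (split e)))))) ⟩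
    cutParity (isAt x) E (odd ∘ h)            ≡⟨ odd-net x E h ⟨
    odd (net x E h)                           ≡⟨ cong odd (net-h x) ⟩
    false ∎

kleinFlow⇒signedFlow : (es : List (EdgeT N)) → KleinFlow es → SignedFlow es
kleinFlow⇒signedFlow es (c , conserved) = ψ , bounded , balanced
  where
  E = lookup es

  orientation : ∀ i → Σ (Fin (length es) → Bool) (Balanced E (bit i ∘ c))
  orientation i = balance E (bit i ∘ c) λ x → trans (sym (parity-at (bit i) (isAt x) E c)) (conserved x i)

  t : Bool → Fin (length es) → ℤ
  t i e = signed (bit i (c e)) (proj₁ (orientation i) e)

  -- With the coefficient 2 the two parts cannot cancel: a zero sum would make `t false e` even,
  -- hence zero, and then `t true e` zero too, but every colour has a nonzero bit.
  ψ : Fin (length es) → ℤ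
  ψ e = t false e +ℤ (t true e +ℤ t true e)

  combine : ∀ k r s → let z = signed (bit false k) r +ℤ (signed (bit true k) s +ℤ signed (bit true k) s)
            in (1 ≤ ∣ z ∣) × (∣ z ∣ ≤ 3)
  combine 0F true  _     = s≤s z≤n , s≤s z≤n
  combine 0F false _     = s≤s z≤n , s≤s z≤n
  combine 1F _     true  = s≤s z≤n , s≤s (s≤s z≤n)
  combine 1F _     false = s≤s z≤n , s≤s (s≤s z≤n)
  combine 2F true  true  = s≤s z≤n , s≤s (s≤s (s≤s z≤n))
  combine 2F true  false = s≤s z≤n , s≤s z≤n
  combine 2F false true  = s≤s z≤n , s≤s z≤n
  combine 2F false false = s≤s z≤n , s≤s (s≤s (s≤s z≤n))

  bounded : ∀ e → (1 ≤ ∣ ψ e ∣) × (∣ ψ e ∣ ≤ 3)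
  bounded e = combine (c e) (proj₁ (orientation false) e) (proj₁ (orientation true) e)

  balanced : ∀ x → net x E ψ ≡ 0ℤ
  balanced x = begin
    net x E ψ                                     ≡⟨ net-+ x E (t false) (λ e → t true e +ℤ t true e) ⟩
    net x E (t false) +ℤ net x E (λ e → t true e +ℤ t true e)
                                                  ≡⟨ cong (net x E (t false) +ℤ_) (net-+ x E (t true) (t true)) ⟩
    net x E (t false) +ℤ (net x E (t true) +ℤ net x E (t true))
      ≡⟨ cong₂ (λ p q → p +ℤ (q +ℤ q)) (proj₂ (orientation false) x) (proj₂ (orientation true) x) ⟩
    0ℤ ∎
    where open ≡-Reasoning

nowhereZero4Flow⇔kleinFlow : (G : Graph) → NowhereZero4Flow G ⇔ KleinFlow (edges G)
nowhereZero4Flow⇔kleinFlow G = mk⇔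
  (signedFlow⇒kleinFlow (edges G) ∘ Equivalence.to (nowhereZero4Flow⇔signedFlow G))
  (Equivalence.from (nowhereZero4Flow⇔signedFlow G) ∘ kleinFlow⇒signedFlow (edges G))

-- Proper colourings as zero sums at vertices of degree three

Proper : List A → Set
Proper = AllPairs _≢_

incidentTo : (End N → Bool) → (Fin m → EdgeT N) → Fin m → Bool → Set
incidentTo w E e s = w (end (E e) s) ≡ true

All-hits⁺ : ∀ b {k : A} → (b ≡ true → P k) → All P (hits b k)
All-hits⁺ true  p = p refl ∷ []
All-hits⁺ false p = []

All-hits⁻ : ∀ b {k : A} → All P (hits b k) → b ≡ true → P k
All-hits⁻ true (p ∷ []) _ = p

All-at⁺ : (w : End N → Bool) (E : Fin m → EdgeT N) (c : Fin m → A) →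
          (∀ e s → incidentTo w E e s → P (c e)) → All P (at w E c)
All-at⁺ {m = zero}  w E c p = []
All-at⁺ {m = suc m} w E c p =
  All-++⁺ (All-hits⁺ (w (proj₁ (E zero))) (p zero false))
  (All-++⁺ (All-hits⁺ (w (proj₂ (E zero))) (p zero true))
           (All-at⁺ w (E ∘ suc) (c ∘ suc) (p ∘ suc)))

All-at⁻ : (w : End N → Bool) (E : Fin m → EdgeT N) (c : Fin m → A) →
          All P (at w E c) → ∀ e s → incidentTo w E e s → P (c e)
All-at⁻ w E c p zero false = All-hits⁻ _ (All-++⁻ˡ (hits (w (proj₁ (E zero))) _) p)
All-at⁻ w E c p zero true  =
  All-hits⁻ _ (All-++⁻ˡ (hits (w (proj₂ (E zero))) _) (All-++⁻ʳ (hits (w (proj₁ (E zero))) _) p))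
All-at⁻ w E c p (suc e) s =
  All-at⁻ w (E ∘ suc) (c ∘ suc)
    (All-++⁻ʳ (hits (w (proj₂ (E zero))) _) (All-++⁻ʳ (hits (w (proj₁ (E zero))) _) p)) e s

Distinguishes : (End N → Bool) → (Fin m → EdgeT N) → (Fin m → A) → Set
Distinguishes w E c = ∀ e f s t → incidentTo w E e s → incidentTo w E f t → (e , s) ≢ (f , t) → c e ≢ c f

proper-at⁺ : (w : End N → Bool) (E : Fin m → EdgeT N) (c : Fin m → A) →
             Distinguishes w E c → Proper (at w E c)
proper-at⁺ {m = zero}  w E c d = []
proper-at⁺ {m = suc m} w E c d with w (proj₁ (E zero)) in wa | w (proj₂ (E zero)) in wb
-- A loop would have to differ in colour from itself.
... | true  | true  = contradiction refl (d zero zero false true wa wb λ ())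
... | true  | false = All-at⁺ w (E ∘ suc) (c ∘ suc) (λ e s we → d zero (suc e) false s wa we λ ()) ∷
                      proper-at⁺ w (E ∘ suc) (c ∘ suc)
                        λ e f s t we wf e≢f → d (suc e) (suc f) s t we wf λ { refl → e≢f refl }
... | false | true  = All-at⁺ w (E ∘ suc) (c ∘ suc) (λ e s we → d zero (suc e) true s wb we λ ()) ∷
                      proper-at⁺ w (E ∘ suc) (c ∘ suc)
                        λ e f s t we wf e≢f → d (suc e) (suc f) s t we wf λ { refl → e≢f refl }
... | false | false = proper-at⁺ w (E ∘ suc) (c ∘ suc)
                        λ e f s t we wf e≢f → d (suc e) (suc f) s t we wf λ { refl → e≢f refl }

proper-first : (w : End N → Bool) (E : Fin (suc m) → EdgeT N) (c : Fin (suc m) → A) → Proper (at w E c) →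
               ∀ s f t → incidentTo w E zero s → incidentTo w E (suc f) t → c zero ≢ c (suc f)
proper-first w E c p false f t we wf with w (proj₁ (E zero)) | p
... | true | q ∷ _ = All-at⁻ w (E ∘ suc) (c ∘ suc) (All-++⁻ʳ (hits (w (proj₂ (E zero))) _) q) f t wf
proper-first w E c p true f t we wf with w (proj₁ (E zero)) | w (proj₂ (E zero)) | p
... | true  | true | _ ∷ q ∷ _ = All-at⁻ w (E ∘ suc) (c ∘ suc) q f t wf
... | false | true | q ∷ _     = All-at⁻ w (E ∘ suc) (c ∘ suc) q f t wf

proper-at⁻ : (w : End N → Bool) (E : Fin m → EdgeT N) (c : Fin m → A) →
             Proper (at w E c) → Distinguishes w E c
proper-at⁻ w E c p zero zero false false _ _ e≢f = contradiction refl e≢f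
proper-at⁻ w E c p zero zero true  true  _ _ e≢f = contradiction refl e≢f
proper-at⁻ w E c p zero zero false true wa wb _ with w (proj₁ (E zero)) | w (proj₂ (E zero)) | p
... | true | true | (k≢k ∷ _) ∷ _ = k≢k
proper-at⁻ w E c p zero zero true false wb wa _ with w (proj₁ (E zero)) | w (proj₂ (E zero)) | p
... | true | true | (k≢k ∷ _) ∷ _ = k≢k
proper-at⁻ w E c p (suc e) zero s t we wf e≢f = ≢-sym (proper-first w E c p t e s wf we)
proper-at⁻ w E c p zero (suc f) s t we wf e≢f = proper-first w E c p s f t we wf
proper-at⁻ w E c p (suc e) (suc f) s t we wf e≢f =
  proper-at⁻ w (E ∘ suc) (c ∘ suc) (rest (w (proj₁ (E zero))) (w (proj₂ (E zero))) p)
             e f s t we wf λ { refl → e≢f refl }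
  where
  rest : ∀ p q {k ks} → Proper (hits p k ++ hits q k ++ ks) → Proper ks
  rest true  true  (_ ∷ _ ∷ r) = r
  rest true  false (_ ∷ r)     = r
  rest false true  (_ ∷ r)     = r
  rest false false r           = r

-- Since the labelling is arbitrary, a constant one turns every correspondence of labellings below
-- into a comparison of degrees.
length-at : (G : Graph) (c : Edge G → A) (x : Fin (n G)) →
            length (at (isAt x) (lookup (edges G)) c) ≡ degree G x
length-at G c x = go (edges G) c
  where
  length-hits : ∀ (a : End (n G)) (k : A) → length (hits (isAt x a) k) ≡ hitℕ a x
  length-hits nothing  k = refl
  length-hits (just y) k with does (y ≟ x)
  ... | true  = refl
  ... | false = refl
  go : ∀ es (c : Fin (length es) → A) → length (at (isAt x) (lookup es) c) ≡ degree (graph (n G) es) x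
  go [] c = refl
  go ((a , b) ∷ es) c = begin
    length (hits (isAt x a) (c zero) ++ hits (isAt x b) (c zero) ++ L)
      ≡⟨ length-++ (hits (isAt x a) (c zero)) ⟩
    length (hits (isAt x a) (c zero)) + length (hits (isAt x b) (c zero) ++ L)
      ≡⟨ cong₂ _+_ (length-hits a (c zero)) (length-++ (hits (isAt x b) (c zero))) ⟩
    hitℕ a x + (length (hits (isAt x b) (c zero)) + length L)
      ≡⟨ cong₂ (λ p q → hitℕ a x + (p + q)) (length-hits b (c zero)) (go es (c ∘ suc)) ⟩
    hitℕ a x + (hitℕ b x + degree (graph (n G) es) x)
      ≡⟨ +-assoc (hitℕ a x) (hitℕ b x) _ ⟨
    (hitℕ a x + hitℕ b x) + degree (graph (n G) es) x ∎
    where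
    open ≡-Reasoning
    L = at (isAt x) (lookup es) (c ∘ suc)

-- The three nonzero elements of ℤ₂ × ℤ₂ add up to zero; checked by evaluation on all triples of
-- colours.
proper⇒zeroSum : ∀ x y z → x ≢ y → x ≢ z → y ≢ z → ∀ i → parity (bit i) (x ∷ y ∷ z ∷ []) ≡ false
proper⇒zeroSum x y z p q r false = toWitness {a? = all? λ x → all? λ y → all? λ z →
  ¬? (x ≟ y) →-dec ¬? (x ≟ z) →-dec ¬? (y ≟ z) →-dec (parity (bit false) (x ∷ y ∷ z ∷ []) ≟ᵇ false)} tt x y z p q r
proper⇒zeroSum x y z p q r true = toWitness {a? = all? λ x → all? λ y → all? λ z →
  ¬? (x ≟ y) →-dec ¬? (x ≟ z) →-dec ¬? (y ≟ z) →-dec (parity (bit true) (x ∷ y ∷ z ∷ []) ≟ᵇ false)} tt x y z p q r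

-- Two equal labels would cancel and force the third to be zero, which is not a colour.
zeroSum⇒proper : ∀ x y z → (∀ i → parity (bit i) (x ∷ y ∷ z ∷ []) ≡ false) → x ≢ y × x ≢ z × y ≢ z
zeroSum⇒proper x y z p = toWitness {a? = all? λ x → all? λ y → all? λ z →
  (parity (bit false) (x ∷ y ∷ z ∷ []) ≟ᵇ false) →-dec (parity (bit true) (x ∷ y ∷ z ∷ []) ≟ᵇ false) →-dec
  ¬? (x ≟ y) ×-dec ¬? (x ≟ z) ×-dec ¬? (y ≟ z)} tt x y z (p false) (p true)

proper⇔zeroSum : (ks : List (Fin 3)) → length ks ≡ 3 → Proper ks ⇔ (∀ i → parity (bit i) ks ≡ false)
proper⇔zeroSum (x ∷ y ∷ z ∷ []) _ = mk⇔
  (λ { ((p ∷ q ∷ []) ∷ (r ∷ []) ∷ [] ∷ []) → proper⇒zeroSum x y z p q r })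
  (λ s → let p , q , r = zeroSum⇒proper x y z s in (p ∷ q ∷ []) ∷ (r ∷ []) ∷ [] ∷ [])

threeEdgeColourable⇔kleinFlow : (G : Graph) → (∀ x → degree G x ≡ 3) →
                                ThreeEdgeColourable G ⇔ KleinFlow (edges G)
threeEdgeColourable⇔kleinFlow G cubic = mk⇔
  (λ { (c , proper) → c , λ x → Equivalence.to (local c x)
       (proper-at⁺ (isAt x) E c λ e f s t we wf →
          proper e f s t x (ends e s x we) (ends f t x wf)) })
  (λ { (c , conserved) → c , λ e f s t x we wf →
       proper-at⁻ (isAt x) E c (Equivalence.from (local c x) (conserved x)) e f s t (hit e s x we) (hit f t x wf) })
  where
  E = lookup (edges G)
  local : ∀ c x → Proper (at (isAt x) E c) ⇔ Conserved E c (isAt x)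
  local c x = proper⇔zeroSum (at (isAt x) E c) (trans (length-at G c x) (cubic x))
  end≡endOf : ∀ e s → end (E e) s ≡ endOf G e s
  end≡endOf e false = refl
  end≡endOf e true  = refl
  ends : ∀ e s x → incidentTo (isAt x) E e s → endOf G e s ≡ just x
  ends e s x we = trans (sym (end≡endOf e s)) (isAt⇒≡ x _ we)
  hit : ∀ e s x → endOf G e s ≡ just x → incidentTo (isAt x) E e s
  hit e s x p = trans (cong (isAt x) (trans (end≡endOf e s) p)) (isAt-self x)

-- Moving labellings along permutations and relabellings of the edge list

at-cong : {w w′ : End N → Bool} → w ≗ w′ → (E : Fin m → EdgeT N) (c : Fin m → A) → at w E c ≡ at w′ E c
at-cong {m = zero}  w≗w′ E c = refl
at-cong {m = suc m} w≗w′ E c =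
  cong₂ _++_ (cong (λ b → hits b (c zero)) (w≗w′ (proj₁ (E zero))))
  (cong₂ _++_ (cong (λ b → hits b (c zero)) (w≗w′ (proj₂ (E zero)))) (at-cong w≗w′ (E ∘ suc) (c ∘ suc)))

parity-↭ : (f : A → Bool) {ks ls : List A} → ks ↭ ls → parity f ks ≡ parity f ls
parity-↭ f ↭.refl = refl
parity-↭ f (↭.prep k p) = cong (f k xor_) (parity-↭ f p)
parity-↭ f (↭.swap {xs = ks} k l p) =
  trans (solve 3 (λ a b c → a :+ (b :+ c) := b :+ (a :+ c)) refl (f k) (f l) (parity f ks))
          (cong (λ q → f l xor (f k xor q)) (parity-↭ f p))
  where open xor-∧-Solver
parity-↭ f (↭.trans p q) = trans (parity-↭ f p) (parity-↭ f q)

-- Each label travels with its edge. The new labelling is chosen before `w`, so the same one serves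
-- all vertices and cuts.
transport : {es fs : List (EdgeT N)} → es ↭ fs → (c : Fin (length es) → A) →
            Σ (Fin (length fs) → A) λ d → ∀ w → at w (lookup es) c ↭ at w (lookup fs) d
transport ↭.refl c = c , λ w → ↭.refl
transport (↭.prep (a , b) p) c with transport p (c ∘ suc)
... | d , q = c zero ◂ d , λ w → ↭ₚ.++⁺ˡ (hits (w a) (c zero)) (↭ₚ.++⁺ˡ (hits (w b) (c zero)) (q w))
transport (↭.swap (a , b) (a′ , b′) p) c with transport p (λ e → c (suc (suc e)))
... | d , q = c (suc zero) ◂ (c zero ◂ d) , λ w →
  let k = c zero ; l = c (suc zero) in
  ↭.trans (↭-reflexive (regroup (hits (w a) k) (hits (w b) k) (hits (w a′) l) (hits (w b′) l) _))
  (↭.trans (↭ₚ.shifts (hits (w a) k ++ hits (w b) k) (hits (w a′) l ++ hits (w b′) l))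
  (↭.trans (↭ₚ.++⁺ˡ (hits (w a′) l ++ hits (w b′) l) (↭ₚ.++⁺ˡ (hits (w a) k ++ hits (w b) k) (q w)))
         (↭-reflexive (sym (regroup (hits (w a′) l) (hits (w b′) l) (hits (w a) k) (hits (w b) k) _)))))
  where
  regroup : (p q r s t : List _) → p ++ q ++ r ++ s ++ t ≡ (p ++ q) ++ (r ++ s) ++ t
  regroup p q r s t = trans (cong (λ u → p ++ q ++ u) (sym (++-assoc r s t))) (sym (++-assoc p q _))
transport (↭.trans p q) c with transport p c
... | d , r with transport q d
...   | d′ , r′ = d′ , λ w → ↭.trans (r w) (r′ w)

-- Selecting ends after the relabelling is selecting them before by the pulled-back `w`. An edge
-- disappears when both its ends become free; `w nothing ≡ false` ensures that its label was not
-- counted.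
restrict : (ρ : Fin N → Maybe (Fin K)) (es : List (EdgeT N)) (c : Fin (length es) → A) →
           Σ (Fin (length (relabel ρ es)) → A) λ d → ∀ w → w nothing ≡ false →
             at w (lookup (relabel ρ es)) d ≡ at (λ a → w (a >>= ρ)) (lookup es) c
restrict ρ [] c = c , λ w _ → refl
restrict ρ ((a , b) ∷ es) c with restrict ρ es (c ∘ suc) | a >>= ρ | b >>= ρ
... | d , q | nothing | nothing = d , λ w w₀ → trans (q w w₀)
        (cong (λ p → hits p (c zero) ++ hits p (c zero) ++ at (λ a → w (a >>= ρ)) (lookup es) (c ∘ suc)) (sym w₀))
... | d , q | nothing | just y = c zero ◂ d , λ w w₀ →
        cong (λ L → hits (w nothing) (c zero) ++ hits (w (just y)) (c zero) ++ L) (q w w₀)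
... | d , q | just x | b′ = c zero ◂ d , λ w w₀ →
        cong (λ L → hits (w (just x)) (c zero) ++ hits (w b′) (c zero) ++ L) (q w w₀)

-- The reverse of `restrict`: the first argument is the default label given to the edges that had
-- disappeared.
extend : A → (ρ : Fin N → Maybe (Fin K)) (es : List (EdgeT N)) (d : Fin (length (relabel ρ es)) → A) →
         Σ (Fin (length es) → A) λ c → ∀ w → w nothing ≡ false →
           at w (lookup (relabel ρ es)) d ≡ at (λ a → w (a >>= ρ)) (lookup es) c
extend k ρ [] d = d , λ w _ → refl
extend k ρ ((a , b) ∷ es) d with a >>= ρ | b >>= ρ
... | nothing | nothing = let c , q = extend k ρ es d in k ◂ c , λ w w₀ → trans (q w w₀)
        (cong (λ p → hits p k ++ hits p k ++ at (λ a → w (a >>= ρ)) (lookup es) c) (sym w₀))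
... | nothing | just y = let c , q = extend k ρ es (d ∘ suc) in d zero ◂ c , λ w w₀ →
        cong (λ L → hits (w nothing) (d zero) ++ hits (w (just y)) (d zero) ++ L) (q w w₀)
... | just x | b′ = let c , q = extend k ρ es (d ∘ suc) in d zero ◂ c , λ w w₀ →
        cong (λ L → hits (w (just x)) (d zero) ++ hits (w b′) (d zero) ++ L) (q w w₀)

conserved-↭ : {ks ls : List (Fin 3)} → ks ↭ ls →
              (∀ i → parity (bit i) ls ≡ false) → ∀ i → parity (bit i) ks ≡ false
conserved-↭ p conserved i = trans (parity-↭ (bit i) p) (conserved i)

-- Vertex maps

dropV-just : {u x : Fin N} (u≢x : u ≢ x) → dropV u x ≡ just (punchOut′ u≢x)
dropV-just {suc N} {u} {x} u≢x with u ≟ x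
... | yes u≡x = contradiction u≡x u≢x
... | no  _   = cong just (punchOut-cong u refl)

dropV-self : (u : Fin N) → dropV u u ≡ nothing
dropV-self {suc N} u with u ≟ u
... | yes _   = refl
... | no  u≢u = contradiction refl u≢u

dropV-≢ : {u x : Fin N} {y : Fin (pred N)} → dropV u x ≡ just y → u ≢ x
dropV-≢ {u = u} p refl with trans (sym (dropV-self u)) p
... | ()

dropV-injective : {u x x′ : Fin N} {y : Fin (pred N)} → dropV u x ≡ just y → dropV u x′ ≡ just y → x ≡ x′
dropV-injective {suc N} {u} {x} {x′} p q with u ≟ x | u ≟ x′
... | no u≢x | no u≢x′ = punchOut-injective u≢x u≢x′ (just-injective (trans p (sym q)))

dropV-surjective : (u : Fin N) (y : Fin (pred N)) → Σ (Fin N) λ x → dropV u x ≡ just y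
dropV-surjective {suc N} u y =
  punchIn u y , trans (dropV-just (punchInᵢ≢i u y ∘ sym)) (cong just (punchOut-punchIn u))

>>=-just : {X Y : Set} (a : Maybe X) (f : X → Maybe Y) {y : Y} →
           (a >>= f) ≡ just y → Σ X λ x → a ≡ just x × f x ≡ just y
>>=-just (just x) f p = x , refl , p

-- The case in which the pulled-back selector of `restrict` and `extend` is again that of a single
-- vertex, so conservation at `y` is conservation at `x`.
Tracks : (Fin N → Maybe (Fin K)) → Fin N → Fin K → Set
Tracks ρ x y = ∀ a → isAt y (a >>= ρ) ≡ isAt x a

tracks : (ρ : Fin N → Maybe (Fin K)) {x : Fin N} {y : Fin K} → ρ x ≡ just y →
         (∀ {z} → ρ z ≡ just y → z ≡ x) → Tracks ρ x y
tracks ρ p unique nothing = refl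
tracks ρ {x} {y} p unique (just z) = ⇔→≡ (mk⇔
  (λ q → trans (cong (isAt x ∘ just) (unique (isAt⇒≡ y (ρ z) q))) (isAt-self x))
  (λ q → trans (cong (isAt y) (trans (cong ρ (just-injective (isAt⇒≡ x (just z) q))) p)) (isAt-self y)))

dropV-tracks : {u x : Fin N} {y : Fin (pred N)} → dropV u x ≡ just y → Tracks (dropV u) x y
dropV-tracks {u = u} p = tracks (dropV u) p λ q → dropV-injective q p

-- Removing and identifying two vertices

-- The common form to which removal, identification and edge deletion are all reduced; it keeps the
-- original vertex set, so no vertex maps remain.
KleinFlowOff : (u v : Fin N) → List (EdgeT N) → Set
KleinFlowOff u v es = Σ (Fin (length es) → Fin 3) λ c →
  ∀ x → x ≢ u → x ≢ v → Conserved (lookup es) c (isAt x)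

module RemoveTwo {N} (u v : Fin N) (u≢v : u ≢ v) where

  v′ : Fin (pred N)
  v′ = punchOut′ u≢v

  ρ : Fin N → Maybe (Fin (pred (pred N)))
  ρ x = dropV u x >>= dropV v′

  ρ-injective : ∀ {x z y} → ρ x ≡ just y → ρ z ≡ just y → z ≡ x
  ρ-injective {x} {z} p q with >>=-just (dropV u x) (dropV v′) p | >>=-just (dropV u z) (dropV v′) q
  ... | x′ , p₁ , p₂ | z′ , q₁ , q₂ = dropV-injective q₁ (trans p₁ (cong just (dropV-injective p₂ q₂)))

  ρ-defined : ∀ x → x ≢ u → x ≢ v → Σ _ λ y → Tracks ρ x y
  ρ-defined x x≢u x≢v = _ , tracks ρ ρx (ρ-injective ρx)
    where
    dx = dropV-just (≢-sym x≢u)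
    v′≢x′ : v′ ≢ punchOut′ (≢-sym x≢u)
    v′≢x′ p = x≢v (dropV-injective dx (trans (dropV-just u≢v) (cong just p)))
    ρx : ρ x ≡ just (punchOut′ v′≢x′)
    ρx = trans (cong (_>>= dropV v′) dx) (dropV-just v′≢x′)

  ρ-onto : ∀ y → Σ (Fin N) λ x → x ≢ u × x ≢ v × Tracks ρ x y
  ρ-onto y with dropV-surjective v′ y
  ... | x′ , p with dropV-surjective u x′
  ...   | x , q = x , ≢-sym (dropV-≢ q) , x≢v , tracks ρ ρx (ρ-injective ρx)
    where
    ρx : ρ x ≡ just y
    ρx = trans (cong (_>>= dropV v′) q) p
    x≢v : x ≢ v
    x≢v refl = dropV-≢ p (just-injective (trans (sym (dropV-just u≢v)) q))

  -- The edges lost by the relabelling have no end outside `u` and `v`, so the default label `0F` on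
  -- their return disturbs no conservation law that is still imposed.
  kleinFlow⇔ : (es : List (EdgeT N)) → KleinFlow (relabel ρ es) ⇔ KleinFlowOff u v es
  kleinFlow⇔ es = mk⇔
    (λ { (d , conserved) → let c , q = extend 0F ρ es d in c , λ x x≢u x≢v →
         let y , t = ρ-defined x x≢u x≢v in
         conserved-↭ (↭-reflexive (sym (trans (q (isAt y) refl) (at-cong t (lookup es) c)))) (conserved y) })
    (λ { (c , conserved) → let d , q = restrict ρ es c in d , λ y →
         let x , x≢u , x≢v , t = ρ-onto y in
         conserved-↭ (↭-reflexive (trans (q (isAt y) refl) (at-cong t (lookup es) c))) (conserved x x≢u x≢v) })

-- Edges cut at `u` or `v` survive as dangling edges, so every remaining vertex keeps all its ends.
-- This is what lets colourings of the reduced graph be read as Klein flows.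
removeTwo-degree : (G : Graph) (u v : Fin (n G)) (u≢v : u ≢ v) → (∀ x → degree G x ≡ 3) →
                   ∀ y → degree (removeTwo G u v u≢v) y ≡ 3
removeTwo-degree G u v u≢v cubic y = begin
  degree (removeTwo G u v u≢v) y                       ≡⟨ length-at (removeTwo G u v u≢v) d y ⟨
  length (at (isAt y) (lookup (relabel ρ (edges G))) d) ≡⟨ cong length (q (isAt y) refl) ⟩
  length (at (λ a → isAt y (a >>= ρ)) E c)             ≡⟨ cong length (at-cong t E c) ⟩
  length (at (isAt x) E c)                             ≡⟨ length-at G c x ⟩
  degree G x                                           ≡⟨ cubic x ⟩
  3                                                    ∎
  where
  open ≡-Reasoning
  open RemoveTwo u v u≢v
  E = lookup (edges G)
  c : Edge G → Fin 3
  c = const 0F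
  d = proj₁ (restrict ρ (edges G) c)
  q = proj₂ (restrict ρ (edges G) c)
  x = proj₁ (ρ-onto y)
  t = proj₂ (proj₂ (proj₂ (ρ-onto y)))

-- For distinct `u` and `v` this selects their union; the exclusive or makes parities additive over
-- the two vertices.
at₂ : Fin N → Fin N → End N → Bool
at₂ u v a = isAt u a xor isAt v a

module Identify {N} (u v : Fin N) (u≢v : u ≢ v) where

  u′ : Fin (pred N)
  u′ = punchOut′ (λ p → u≢v (sym p))

  ρ : Fin N → Maybe (Fin (pred N))
  ρ x = just (maybe′ (λ y → y) u′ (dropV v x))

  dropV-u : dropV v u ≡ just u′
  dropV-u = dropV-just (λ p → u≢v (sym p))

  ρ-just : ∀ {x y} → dropV v x ≡ just y → ρ x ≡ just y
  ρ-just p = cong (λ a → just (maybe′ (λ y → y) u′ a)) p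

  ρ-v : ρ v ≡ just u′
  ρ-v = cong (λ a → just (maybe′ (λ y → y) u′ a)) (dropV-self v)

  ρ-inverse : ∀ {z y} → y ≢ u′ → ρ z ≡ just y → dropV v z ≡ just y
  ρ-inverse {z} y≢u′ p with dropV v z
  ... | just _  = p
  ... | nothing = contradiction (sym (just-injective p)) y≢u′

  ρ-tracks : ∀ {x y} → y ≢ u′ → dropV v x ≡ just y → Tracks ρ x y
  ρ-tracks y≢u′ p = tracks ρ (ρ-just p) λ q → dropV-injective (ρ-inverse y≢u′ q) p

  ρ-merge : ∀ a → isAt u′ (a >>= ρ) ≡ at₂ u v a
  ρ-merge nothing = refl
  ρ-merge (just z) with z ≟ v | z ≟ u
  ... | yes z≡v | yes z≡u = contradiction (trans (sym z≡u) z≡v) u≢v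
  ... | yes refl | no _ = trans (cong (isAt u′) ρ-v) (isAt-self u′)
  ... | no _ | yes refl = trans (cong (isAt u′) (ρ-just dropV-u)) (isAt-self u′)
  ... | no z≢v | no z≢u = trans (cong (isAt u′) (ρ-just (dropV-just (≢-sym z≢v)))) (isAt-other z′≢u′)
    where
    z′≢u′ : punchOut′ (≢-sym z≢v) ≢ u′
    z′≢u′ p = z≢u (dropV-injective (dropV-just (≢-sym z≢v)) (trans dropV-u (cong just (sym p))))

  ρ-defined : ∀ x → x ≢ u → x ≢ v → Σ _ λ y → Tracks ρ x y
  ρ-defined x x≢u x≢v = _ , ρ-tracks x′≢u′ dx
    where
    dx = dropV-just (≢-sym x≢v)
    x′≢u′ : punchOut′ (≢-sym x≢v) ≢ u′
    x′≢u′ p = x≢u (dropV-injective dx (trans dropV-u (cong just (sym p))))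

  kleinFlow⇒off : (es : List (EdgeT N)) → KleinFlow (relabel ρ es) → KleinFlowOff u v es
  kleinFlow⇒off es (d , conserved) = let c , q = extend 0F ρ es d in c , λ x x≢u x≢v →
    let y , t = ρ-defined x x≢u x≢v in
    conserved-↭ (↭-reflexive (sym (trans (q (isAt y) refl) (at-cong t (lookup es) c)))) (conserved y)

  -- The premise on `at₂ u v` is conservation at the merged vertex. An edge joining `u` and `v`
  -- becomes a loop there and cancels itself.
  off⇒kleinFlow : (es : List (EdgeT N)) (flow : KleinFlowOff u v es) →
                  Conserved (lookup es) (proj₁ flow) (at₂ u v) → KleinFlow (relabel ρ es)
  off⇒kleinFlow es (c , conserved) merged = d , local
    where
    d = proj₁ (restrict ρ es c)
    q = proj₂ (restrict ρ es c)
    local : ∀ y → Conserved (lookup (relabel ρ es)) d (isAt y)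
    local y with y ≟ u′
    ... | yes refl = conserved-↭ (↭-reflexive (trans (q (isAt u′) refl) (at-cong ρ-merge (lookup es) c))) merged
    ... | no y≢u′ with dropV-surjective v y
    ...   | x , p = conserved-↭
              (↭-reflexive (trans (q (isAt y) refl) (at-cong (ρ-tracks y≢u′ p) (lookup es) c)))
              (conserved x (λ { refl → y≢u′ (just-injective (trans (sym p) dropV-u)) }) (≢-sym (dropV-≢ p)))

-- The parity lemma

sum-false : {f : Fin m → Bool} → (∀ i → f i ≡ false) → ⊕.sum f ≡ false
sum-false {m = zero}  p = refl
sum-false {m = suc m} p = cong₂ _xor_ (p zero) (sum-false (p ∘ suc))

∧-sum : (b : Bool) (f : Fin m → Bool) → b ∧ ⊕.sum f ≡ ⊕.sum (λ i → b ∧ f i)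
∧-sum true  f = refl
∧-sum {m} false f = sym (sum-false {m} {λ _ → false} λ _ → refl)

indicator-sum : (g : Fin N → Bool) (a : End N) → maybe′ g false a ≡ ⊕.sum (λ x → g x ∧ isAt x a)
indicator-sum g nothing = sym (sum-false λ x → ∧-zeroʳ (g x))
indicator-sum {N} g (just y) = begin
  g y                                  ≡⟨ ∧-identityʳ (g y) ⟨
  g y ∧ true                           ≡⟨ cong (g y ∧_) (isAt-self y) ⟨
  f y                                  ≡⟨ cong (_xor f y) (sum-false {N} {λ _ → false} λ _ → refl) ⟨
  ⊕.sum (λ (_ : Fin N) → false) xor f y ≡⟨ ⊕.sum-change y f (λ _ → false) (λ j j≢y →
       trans (cong (g j ∧_) (isAt-other (≢-sym j≢y))) (∧-zeroʳ (g j))) ⟨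
  ⊕.sum f xor false                    ≡⟨ xor-identityʳ (⊕.sum f) ⟩
  ⊕.sum f                              ∎
  where
  open ≡-Reasoning
  f : Fin N → Bool
  f x = g x ∧ isAt x (just y)

-- Double counting: in the sum of the parities over the vertices of the region, edges inside it
-- count twice and cancel, leaving the edges of the boundary.
cutParity-region : (E : Fin m → EdgeT N) (β : Fin m → Bool) (g : Fin N → Bool) →
                   (∀ x → g x ≡ true → cutParity (isAt x) E β ≡ false) →
                   cutParity (maybe′ g false) E β ≡ false
cutParity-region {m} {N} E β g even = begin
  ⊕.sum (λ e → β e ∧ crosses (maybe′ g false) (E e))
    ≡⟨ ⊕.sum-cong-≗ expand ⟩
  ⊕.sum (λ e → ⊕.sum (λ x → g x ∧ (β e ∧ crosses (isAt x) (E e))))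
    ≡⟨ ⊕.∑-comm (λ e x → g x ∧ (β e ∧ crosses (isAt x) (E e))) ⟩
  ⊕.sum (λ x → ⊕.sum (λ e → g x ∧ (β e ∧ crosses (isAt x) (E e))))
    ≡⟨ sum-false (λ x → trans (sym (∧-sum (g x) (λ e → β e ∧ crosses (isAt x) (E e)))) (vanish x)) ⟩
  false ∎
  where
  open ≡-Reasoning
  vanish : ∀ x → g x ∧ cutParity (isAt x) E β ≡ false
  vanish x with g x in gx
  ... | true  = even x gx
  ... | false = refl
  expand : ∀ e → β e ∧ crosses (maybe′ g false) (E e) ≡ ⊕.sum (λ x → g x ∧ (β e ∧ crosses (isAt x) (E e)))
  expand e = begin
    β e ∧ (maybe′ g false a xor maybe′ g false b)
      ≡⟨ cong₂ (λ p q → β e ∧ (p xor q)) (indicator-sum g a) (indicator-sum g b) ⟩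
    β e ∧ (⊕.sum (λ x → g x ∧ isAt x a) xor ⊕.sum (λ x → g x ∧ isAt x b))
      ≡⟨ cong (β e ∧_) (⊕.∑-distrib-+ (λ x → g x ∧ isAt x a) (λ x → g x ∧ isAt x b)) ⟨
    β e ∧ ⊕.sum (λ x → (g x ∧ isAt x a) xor (g x ∧ isAt x b))
      ≡⟨ ∧-sum (β e) (λ x → (g x ∧ isAt x a) xor (g x ∧ isAt x b)) ⟩
    ⊕.sum (λ x → β e ∧ ((g x ∧ isAt x a) xor (g x ∧ isAt x b)))
      ≡⟨ ⊕.sum-cong-≗ (λ x → solve 4 (λ p q r s → p :* ((q :* r) :+ (q :* s)) := q :* (p :* (r :+ s)))
                               refl (β e) (g x) (isAt x a) (isAt x b)) ⟩
    ⊕.sum (λ x → g x ∧ (β e ∧ (isAt x a xor isAt x b))) ∎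
    where
    open xor-∧-Solver
    a = proj₁ (E e)
    b = proj₂ (E e)

NoFreeEnd : EdgeT N → Set
NoFreeEnd (a , b) = a ≢ nothing × b ≢ nothing

-- The set of `u` and `v` has the same cut as its complement, where every vertex is conserved. This
-- needs closed edges: a free end lies in neither set, so a dangling edge would cross only one of
-- the two cuts.
conserved-at₂ : (u v : Fin N) → u ≢ v → (es : List (EdgeT N)) → All NoFreeEnd es → (flow : KleinFlowOff u v es) →
                Conserved (lookup es) (proj₁ flow) (at₂ u v)
conserved-at₂ {N} u v u≢v es closed (c , conserved) i = begin
  parity (bit i) (at (at₂ u v) E c)            ≡⟨ parity-at (bit i) (at₂ u v) E c ⟩
  cutParity (at₂ u v) E (bit i ∘ c)            ≡⟨ ⊕.sum-cong-≗ (λ e → cong (bit i (c e) ∧_) (complement (E e) (All.lookup closed (∈-lookup e)))) ⟩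
  cutParity (maybe′ g false) E (bit i ∘ c)     ≡⟨ cutParity-region E (bit i ∘ c) g even ⟩
  false                                        ∎
  where
  open ≡-Reasoning
  E = lookup es
  g : Fin N → Bool
  g x = not (at₂ u v (just x))
  complement : ∀ ab → NoFreeEnd ab → crosses (at₂ u v) ab ≡ crosses (maybe′ g false) ab
  complement (just x  , just y)  _         = sym (xor-annihilates-not (at₂ u v (just x)) (at₂ u v (just y)))
  complement (nothing , _)       (p , _)   = contradiction refl p
  complement (just _  , nothing) (_ , q)   = contradiction refl q
  g-u : g u ≡ false
  g-u rewrite isAt-self u | isAt-other {x = v} u≢v = refl
  g-v : g v ≡ false
  g-v rewrite isAt-self v | isAt-other {x = u} (≢-sym u≢v) = refl
  even : ∀ x → g x ≡ true → cutParity (isAt x) E (bit i ∘ c) ≡ false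
  even x gx = trans (sym (parity-at (bit i) (isAt x) E c))
    (conserved x (λ { refl → true≢false (trans (sym gx) g-u) })
                 (λ { refl → true≢false (trans (sym gx) g-v) }) i)
    where
    true≢false : true ≢ false
    true≢false ()

parity-at₂ : (u v : Fin N) (f : A → Bool) (E : Fin m → EdgeT N) (c : Fin m → A) →
             parity f (at (at₂ u v) E c) ≡ parity f (at (isAt u) E c) xor parity f (at (isAt v) E c)
parity-at₂ u v f E c = begin
  parity f (at (at₂ u v) E c)
    ≡⟨ parity-at f (at₂ u v) E c ⟩
  cutParity (at₂ u v) E (f ∘ c)
    ≡⟨ ⊕.sum-cong-≗ (λ e → solve 5 (λ k p q r s → k :* ((p :+ q) :+ (r :+ s)) := (k :* (p :+ r)) :+ (k :* (q :+ s)))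
         refl (f (c e)) (isAt u (proj₁ (E e))) (isAt v (proj₁ (E e))) (isAt u (proj₂ (E e))) (isAt v (proj₂ (E e)))) ⟩
  ⊕.sum (λ e → (f (c e) ∧ crosses (isAt u) (E e)) xor (f (c e) ∧ crosses (isAt v) (E e)))
    ≡⟨ ⊕.∑-distrib-+ (λ e → f (c e) ∧ crosses (isAt u) (E e)) (λ e → f (c e) ∧ crosses (isAt v) (E e)) ⟩
  cutParity (isAt u) E (f ∘ c) xor cutParity (isAt v) E (f ∘ c)
    ≡⟨ cong₂ _xor_ (parity-at f (isAt u) E c) (parity-at f (isAt v) E c) ⟨
  parity f (at (isAt u) E c) xor parity f (at (isAt v) E c) ∎
  where
  open ≡-Reasoning
  open xor-∧-Solver

-- Deleting an edge

removeAt-↭ : {X : Set} (xs : List X) (i : Fin (length xs)) → xs ↭ lookup xs i ∷ removeAt xs i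
removeAt-↭ (x ∷ xs) zero = ↭.refl
removeAt-↭ (x ∷ xs) (suc i) = ↭.trans (↭.prep x (removeAt-↭ xs i)) (↭.swap x (lookup xs i) ↭.refl)

Ends : EdgeT N → Fin N → Fin N → Set
Ends ab u v = (ab ≡ (just u , just v)) ⊎ (ab ≡ (just v , just u))

-- One unfolding of `at` with the first edge made explicit, so that its contribution can be
-- rewritten on its own.
edgeAt : (End N → Bool) → EdgeT N → A → List A → List A
edgeAt w (a , b) k L = hits (w a) k ++ hits (w b) k ++ L

edgeAt-off : {ab : EdgeT N} {u v x : Fin N} → Ends ab u v → x ≢ u → x ≢ v →
             (k : A) (L : List A) → edgeAt (isAt x) ab k L ≡ L
edgeAt-off {u = u} {v} {x} ends x≢u x≢v k L with ends
... | inj₁ refl rewrite isAt-other {x = x} (≢-sym x≢u) | isAt-other {x = x} (≢-sym x≢v) = refl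
... | inj₂ refl rewrite isAt-other {x = x} (≢-sym x≢u) | isAt-other {x = x} (≢-sym x≢v) = refl

edgeAt-on : {ab : EdgeT N} {u v : Fin N} → u ≢ v → Ends ab u v →
            (k : A) (L : List A) → edgeAt (isAt u) ab k L ≡ k ∷ L
edgeAt-on {u = u} {v} u≢v ends k L with ends
... | inj₁ refl rewrite isAt-self u | isAt-other {x = u} (≢-sym u≢v) = refl
... | inj₂ refl rewrite isAt-self u | isAt-other {x = u} (≢-sym u≢v) = refl

-- An element of ℤ₂ × ℤ₂ is either zero or a colour; applied to the excess at `u`, this decides
-- whether the deleted edge has a label to carry.
nonzero-colour : (p : Bool → Bool) → (∀ i → p i ≡ false) ⊎ (Σ (Fin 3) λ k → ∀ i → bit i k ≡ p i)
nonzero-colour p with p false in p₀ | p true in p₁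
... | false | false = inj₁ λ { false → p₀ ; true → p₁ }
... | true  | false = inj₂ (0F , λ { false → sym p₀ ; true → sym p₁ })
... | false | true  = inj₂ (1F , λ { false → sym p₀ ; true → sym p₁ })
... | true  | true  = inj₂ (2F , λ { false → sym p₀ ; true → sym p₁ })

module DeleteEdge (G : Graph) (e : Edge G) (u v : Fin (n G)) (u≢v : u ≢ v) (joins : Joins G e u v) where

  es es′ : List (EdgeT (n G))
  es  = edges G
  es′ = removeAt es e

  -- Both ends of `e` lie at `u` and `v`, so its label is invisible at all other vertices; `0F` is
  -- an arbitrary choice when `e` is put back.
  off⇔ : KleinFlowOff u v es ⇔ KleinFlowOff u v es′
  off⇔ = mk⇔
    (λ { (c , conserved) → let d , q = transport (removeAt-↭ es e) c in d ∘ suc , λ x x≢u x≢v →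
         conserved-↭ (↭.trans (↭-reflexive (sym (edgeAt-off joins x≢u x≢v (d zero) _))) (↭-sym (q (isAt x))))
                     (conserved x x≢u x≢v) })
    (λ { (c , conserved) → let d , q = transport (↭-sym (removeAt-↭ es e)) (0F ◂ c) in d , λ x x≢u x≢v →
         conserved-↭ (↭.trans (↭-sym (q (isAt x))) (↭-reflexive (edgeAt-off joins x≢u x≢v 0F _)))
                     (conserved x x≢u x≢v) })

  -- A nonzero excess at u equals the one at v, so that it could be used as the colour of e.
  off⇒kleinFlow : All NoFreeEnd es′ → ¬ KleinFlow es → KleinFlowOff u v es′ → KleinFlow es′
  off⇒kleinFlow closed noFlow flow@(c , conserved) with nonzero-colour (λ i → parity (bit i) (at (isAt u) (lookup es′) c))
  ... | inj₁ conserved-u = c , local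
    where
    local : ∀ x → Conserved (lookup es′) c (isAt x)
    local x with x ≟ u | x ≟ v
    ... | yes refl | _          = conserved-u
    ... | no _       | yes refl = λ i → trans (sym (trans
            (parity-at₂ u v (bit i) (lookup es′) c)
            (cong (_xor parity (bit i) (at (isAt v) (lookup es′) c)) (conserved-u i))))
            (conserved-at₂ u v u≢v es′ closed flow i)
    ... | no x≢u     | no x≢v     = conserved x x≢u x≢v
  ... | inj₂ (k , excess) = contradiction (d , local) noFlow
    where
    d = proj₁ (transport (↭-sym (removeAt-↭ es e)) (k ◂ c))
    q = proj₂ (transport (↭-sym (removeAt-↭ es e)) (k ◂ c))
    sumAt : Fin (n G) → Bool → Bool
    sumAt x i = parity (bit i) (at (isAt x) (lookup es′) c)
    xor≡false : ∀ p q → p xor q ≡ false → p ≡ q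
    xor≡false false false _ = refl
    xor≡false true  true  _ = refl
    sumAt-v : ∀ i → sumAt u i ≡ sumAt v i
    sumAt-v i = xor≡false (sumAt u i) (sumAt v i)
      (trans (sym (parity-at₂ u v (bit i) (lookup es′) c)) (conserved-at₂ u v u≢v es′ closed flow i))
    closes : ∀ {x} L → at (isAt x) (lookup es) d ↭ k ∷ L → (∀ i → bit i k ≡ parity (bit i) L) →
             Conserved (lookup es) d (isAt x)
    closes L p excess i = trans (parity-↭ (bit i) p)
      (trans (cong (_xor parity (bit i) L) (excess i)) (xor-same (parity (bit i) L)))
    local : ∀ x → Conserved (lookup es) d (isAt x)
    local x with x ≟ u | x ≟ v
    ... | yes refl | _          = closes _ (↭.trans (↭-sym (q (isAt u))) (↭-reflexive (edgeAt-on u≢v joins k _))) excess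
    ... | no _       | yes refl = closes _ (↭.trans (↭-sym (q (isAt v))) (↭-reflexive (edgeAt-on (≢-sym u≢v) (Sum.swap joins) k _)))
                                           (λ i → trans (excess i) (sumAt-v i))
    ... | no x≢u     | no x≢v     =
            conserved-↭ (↭.trans (↭-sym (q (isAt x))) (↭-reflexive (edgeAt-off joins x≢u x≢v k _))) (conserved x x≢u x≢v)

  private
    c₀ : Edge G → Fin 3
    c₀ _ = 0F
    d₀ = proj₁ (transport (removeAt-↭ es e) c₀)
    q₀ = proj₂ (transport (removeAt-↭ es e) c₀)

    degree-at : ∀ x → degree G x ≡ length (edgeAt (isAt x) (lookup es e) (d₀ zero) (at (isAt x) (lookup es′) (d₀ ∘ suc)))
    degree-at x = trans (sym (length-at G c₀ x)) (↭ₚ.↭-length (q₀ (isAt x)))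

  degree-off : ∀ x → x ≢ u → x ≢ v → degree (deleteEdge G e) x ≡ degree G x
  degree-off x x≢u x≢v = sym (trans (degree-at x) (trans
    (cong length (edgeAt-off joins x≢u x≢v (d₀ zero) _)) (length-at (deleteEdge G e) (d₀ ∘ suc) x)))

  degree-u : degree G u ≡ suc (degree (deleteEdge G e) u)
  degree-u = trans (degree-at u) (trans
    (cong length (edgeAt-on u≢v joins (d₀ zero) _)) (cong suc (length-at (deleteEdge G e) (d₀ ∘ suc) u)))

  degree-v : degree G v ≡ suc (degree (deleteEdge G e) v)
  degree-v = trans (degree-at v) (trans
    (cong length (edgeAt-on (≢-sym u≢v) (Sum.swap joins) (d₀ zero) _)) (cong suc (length-at (deleteEdge G e) (d₀ ∘ suc) v)))

-- Suppressing a vertex of degree two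

atG : (End N → Bool) → (es : List (EdgeT N)) → (Fin (length es) → A) → List A
atG w es = at w (lookup es)

splitAt-↭ : (x : Fin N) (es : List (EdgeT N)) → es ↭ proj₁ (splitAt x es) ++ proj₂ (splitAt x es)
splitAt-↭ x [] = ↭.refl
splitAt-↭ x (ab ∷ es) with splitAt x es | splitAt-↭ x es
... | I , R | p with incident x ab
...   | true  = ↭.prep ab p
...   | false = ↭.trans (↭.prep ab p) (↭-sym (↭ₚ.shift ab I R))

splitAt-incident : (x : Fin N) (es : List (EdgeT N)) → All (λ ab → incident x ab ≡ true) (proj₁ (splitAt x es))
splitAt-incident x [] = []
splitAt-incident x (ab ∷ es) with splitAt x es | splitAt-incident x es
... | I , R | p with incident x ab in eq
...   | true  = eq ∷ p
...   | false = p

splitAt-avoiding : (x : Fin N) (es : List (EdgeT N)) → All (λ ab → incident x ab ≡ false) (proj₂ (splitAt x es))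
splitAt-avoiding x [] = []
splitAt-avoiding x (ab ∷ es) with splitAt x es | splitAt-avoiding x es
... | I , R | p with incident x ab in eq
...   | true  = p
...   | false = eq ∷ p

at-avoiding : (x : Fin N) {R : List (EdgeT N)} → All (λ ab → incident x ab ≡ false) R →
              (c : Fin (length R) → A) → atG (isAt x) R c ≡ []
at-avoiding x [] c = refl
at-avoiding x (_∷_ {a , b} p ps) c with isAt x a | isAt x b
... | false | false = at-avoiding x ps (c ∘ suc)
at-avoiding x (_∷_ {a , b} () ps) c | false | true
at-avoiding x (_∷_ {a , b} () ps) c | true  | _

OneEnd : Fin N → EdgeT N → Set
OneEnd x ab = crosses (isAt x) ab ≡ true

oneEnd-at : (x : Fin N) (ab : EdgeT N) → OneEnd x ab → (k : A) (L : List A) → edgeAt (isAt x) ab k L ≡ k ∷ L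
oneEnd-at x (a , b) p k L with isAt x a | isAt x b
... | true  | false = refl
... | false | true  = refl

oneEnd-other : (x : Fin N) (ab : EdgeT N) → OneEnd x ab → (w : End N → Bool) → w (just x) ≡ false →
               (k : A) (L : List A) → edgeAt w ab k L ≡ hits (w (otherEnd x ab)) k ++ L
oneEnd-other x (a , b) p w wx k L with isAt x a in xa | isAt x b in xb
... | true  | false rewrite isAt⇒≡ x a xa | wx = refl
... | false | true  rewrite isAt⇒≡ x b xb | wx = refl

-- These are the two outcomes of `joinEnds` at a vertex of degree two: no new edge, or one. In the
-- second, both edges may lead to the same neighbour, and the new edge is then a loop.
data DegreeTwo (x : Fin N) : List (EdgeT N) → Set where
  loop : DegreeTwo x ((just x , just x) ∷ [])
  path : ∀ {f g} → OneEnd x f → OneEnd x g → DegreeTwo x (f ∷ g ∷ [])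

module _ (x : Fin N) (R : List (EdgeT N)) where

  Incident : List (EdgeT N) → Set
  Incident = All (λ ab → incident x ab ≡ true)

  no-edge : ∀ I → Incident I → (c : Fin (length (I ++ R)) → A) → length (atG (isAt x) (I ++ R) c) ≡ 0 → I ≡ []
  no-edge [] _ c _ = refl
  no-edge ((a , b) ∷ I) (p ∷ _) c q with isAt x a | isAt x b
  no-edge ((a , b) ∷ I) (p ∷ _) c ()  | true  | _
  no-edge ((a , b) ∷ I) (p ∷ _) c ()  | false | true
  no-edge ((a , b) ∷ I) (() ∷ _) c q  | false | false

  one-edge : All (λ ab → incident x ab ≡ false) R → ∀ I → Incident I → (c : Fin (length (I ++ R)) → A) →
             length (atG (isAt x) (I ++ R) c) ≡ 1 → Σ (EdgeT N) λ g → I ≡ g ∷ [] × OneEnd x g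
  one-edge avoiding [] _ c q with trans (sym q) (cong length (at-avoiding x avoiding c))
  ... | ()
  one-edge avoiding ((a , b) ∷ I) (p ∷ ps) c q with isAt x a in xa | isAt x b in xb
  one-edge avoiding ((a , b) ∷ I) (p ∷ ps) c () | true | true
  ... | true  | false = (a , b) , cong ((a , b) ∷_) (no-edge I ps (c ∘ suc) (suc-injectiveℕ q)) , cong₂ _xor_ xa xb
  ... | false | true  = (a , b) , cong ((a , b) ∷_) (no-edge I ps (c ∘ suc) (suc-injectiveℕ q)) , cong₂ _xor_ xa xb
  one-edge avoiding ((a , b) ∷ I) (() ∷ ps) c q | false | false

  -- All ends at `x` come from `I`, and each edge of `I` uses at least one, so the count 2 is
  -- exhausted by a loop or by two edges with one end each.
  degreeTwo : All (λ ab → incident x ab ≡ false) R → ∀ I → Incident I → (c : Fin (length (I ++ R)) → A) →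
              length (atG (isAt x) (I ++ R) c) ≡ 2 → DegreeTwo x I
  degreeTwo avoiding [] _ c q with trans (sym q) (cong length (at-avoiding x avoiding c))
  ... | ()
  degreeTwo avoiding ((a , b) ∷ I) (p ∷ ps) c q with isAt x a in xa | isAt x b in xb
  ... | true | true
    rewrite no-edge I ps (c ∘ suc) (suc-injectiveℕ (suc-injectiveℕ q)) | isAt⇒≡ x a xa | isAt⇒≡ x b xb = loop
  ... | true | false with one-edge avoiding I ps (c ∘ suc) (suc-injectiveℕ q)
  ...   | g , refl , og = path (cong₂ _xor_ xa xb) og
  degreeTwo avoiding ((a , b) ∷ I) (p ∷ ps) c q | false | true with one-edge avoiding I ps (c ∘ suc) (suc-injectiveℕ q)
  ...   | g , refl , og = path (cong₂ _xor_ xa xb) og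
  degreeTwo avoiding ((a , b) ∷ I) (() ∷ ps) c q | false | false

-- Every element of ℤ₂ × ℤ₂ is its own negative, so two labels with zero sum coincide.
bit-separates : ∀ k l → (∀ i → parity (bit i) (k ∷ l ∷ []) ≡ false) → k ≡ l
bit-separates k l p = toWitness {a? = all? λ k → all? λ l →
  (parity (bit false) (k ∷ l ∷ []) ≟ᵇ false) →-dec (parity (bit true) (k ∷ l ∷ []) ≟ᵇ false) →-dec (k ≟ l)}
  tt k l (p false) (p true)

module Smoothing (x : Fin N) (R : List (EdgeT N)) (avoiding : All (λ ab → incident x ab ≡ false) R) where

  Agree : (I : List (EdgeT N)) → (Fin (length (I ++ R)) → Fin 3) → (Fin (length (R ++ joinEnds x I)) → Fin 3) → Set
  Agree I c d = ∀ w → w (just x) ≡ false → atG w (I ++ R) c ↭ atG w (R ++ joinEnds x I) d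

  loop-at : ∀ w → w (just x) ≡ false → (k : Fin 3) (L : List (Fin 3)) → edgeAt w (just x , just x) k L ≡ L
  loop-at w wx k L rewrite wx = refl

  path-at : ∀ {f g} → OneEnd x f → OneEnd x g → ∀ w → w (just x) ≡ false → (k : Fin 3) (L : List (Fin 3)) →
            edgeAt w f k (edgeAt w g k L) ≡ edgeAt w (otherEnd x f , otherEnd x g) k L
  path-at {f} {g} of og w wx k L = trans (oneEnd-other x f of w wx k _)
    (cong (hits (w (otherEnd x f)) k ++_) (oneEnd-other x g og w wx k L))

  -- Conservation at `x` forces equal labels on the two edges, and the joining edge inherits their
  -- common value. A loop at `x` is not seen from any other vertex.
  smooth-flow : ∀ {I} → DegreeTwo x I → (c : Fin (length (I ++ R)) → Fin 3) →
                Conserved (lookup (I ++ R)) c (isAt x) → Σ _ (Agree I c)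
  smooth-flow loop c _ = let d , q = transport (↭-sym (↭ₚ.++-identityʳ R)) (c ∘ suc) in
    d , λ w wx → ↭.trans (↭-reflexive (loop-at w wx (c zero) _)) (q w)
  smooth-flow (path {f} {g} of og) c conserved = let d , q = transport perm (k ◂ c″) in
    d , λ w wx → ↭.trans (↭-reflexive (trans
      (cong (λ l → edgeAt w f k (edgeAt w g l (atG w R c″))) (sym k≡l))
      (path-at of og w wx k (atG w R c″)))) (q w)
    where
    k l : Fin 3
    k = c zero
    l = c (suc zero)
    c″ : Fin (length R) → Fin 3
    c″ e = c (suc (suc e))
    perm : (otherEnd x f , otherEnd x g) ∷ R ↭ R ++ (otherEnd x f , otherEnd x g) ∷ []
    perm = ↭ₚ.++-comm ((otherEnd x f , otherEnd x g) ∷ []) R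
    at-x : atG (isAt x) (f ∷ g ∷ R) c ≡ k ∷ l ∷ []
    at-x = trans (oneEnd-at x f of k _) (cong (k ∷_) (trans (oneEnd-at x g og l _)
             (cong (l ∷_) (at-avoiding x avoiding c″))))
    k≡l : k ≡ l
    k≡l = bit-separates k l λ i → trans (cong (parity (bit i)) (sym at-x)) (conserved i)

  -- Both halves of a subdivided edge get its label, which cancels at `x`; on a restored loop any
  -- label cancels, and `0F` is taken. So no conservation is assumed of `d`.
  unsmooth-flow : ∀ {I} → DegreeTwo x I → (d : Fin (length (R ++ joinEnds x I)) → Fin 3) →
                  Σ _ λ c → Conserved (lookup (I ++ R)) c (isAt x) × Agree I c d
  unsmooth-flow loop d = let c , q = transport (↭ₚ.++-identityʳ R) d in
    0F ◂ c ,
    conserved-↭ (↭-reflexive (trans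
      (cong (λ p → hits p 0F ++ hits p 0F ++ atG (isAt x) R c) (isAt-self x))
      (cong (λ L → 0F ∷ 0F ∷ L) (at-avoiding x avoiding c)))) (λ { false → refl ; true → refl }) ,
    λ w wx → ↭.trans (↭-reflexive (loop-at w wx 0F _)) (↭-sym (q w))
  unsmooth-flow (path {f} {g} of og) d = let c , q = transport perm d in
    c zero ◂ c ,
    conserved-↭ (↭-reflexive (trans (oneEnd-at x f of (c zero) _) (cong (c zero ∷_)
      (trans (oneEnd-at x g og (c zero) _) (cong (c zero ∷_) (at-avoiding x avoiding (c ∘ suc)))))))
      (λ i → twice (bit i (c zero))) ,
    λ w wx → ↭.trans (↭-reflexive (path-at of og w wx (c zero) _)) (↭-sym (q w))
    where
    perm : R ++ (otherEnd x f , otherEnd x g) ∷ [] ↭ (otherEnd x f , otherEnd x g) ∷ R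
    perm = ↭ₚ.++-comm R ((otherEnd x f , otherEnd x g) ∷ [])
    twice : ∀ b → b xor (b xor false) ≡ false
    twice true  = refl
    twice false = refl

module Suppress (G : Graph) (x : Fin (n G)) (degree-x : degree G x ≡ 2) where

  es I R : List (EdgeT (n G))
  es = edges G
  I  = proj₁ (splitAt x es)
  R  = proj₂ (splitAt x es)

  open Smoothing x R (splitAt-avoiding x es)

  view : DegreeTwo x I
  view = let c , q = transport {A = Fin 3} (splitAt-↭ x es) (const 0F) in
    degreeTwo x R (splitAt-avoiding x es) I (splitAt-incident x es) c
      (trans (trans (sym (↭ₚ.↭-length (q (isAt x)))) (length-at G (const 0F) x)) degree-x)

  Matches : (Edge G → Fin 3) → (Edge (suppress G x) → Fin 3) → Set
  Matches c d = ∀ {z y} → dropV x z ≡ just y → atG (isAt z) es c ↭ atG (isAt y) (edges (suppress G x)) d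

  away : ∀ {z y} → dropV x z ≡ just y → isAt z (just x) ≡ false
  away {z} p = isAt-other {x = z} (dropV-≢ {u = x} {z} p)

  push : (c : Edge G → Fin 3) → Conserved (lookup es) c (isAt x) → Σ _ (Matches c)
  push c conserved with transport (splitAt-↭ x es) c
  ... | c₁ , q₁ with smooth-flow view c₁ (conserved-↭ (↭-sym (q₁ (isAt x))) conserved)
  ...   | c₂ , q₂ with restrict (dropV x) (R ++ joinEnds x I) c₂
  ...     | d , q₃ = d , λ {z} {y} p → ↭.trans (q₁ (isAt z)) (↭.trans (q₂ (isAt z) (away p))
              (↭-reflexive (sym (trans (q₃ (isAt y) refl) (at-cong (dropV-tracks p) (lookup (R ++ joinEnds x I)) c₂)))))

  pull : (d : Edge (suppress G x) → Fin 3) → Σ _ λ c → Conserved (lookup es) c (isAt x) × Matches c d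
  pull d with extend 0F (dropV x) (R ++ joinEnds x I) d
  ... | c₂ , q₃ with unsmooth-flow view c₂
  ...   | c₁ , conserved , q₂ with transport (↭-sym (splitAt-↭ x es)) c₁
  ...     | c , q₁ = c , conserved-↭ (↭-sym (q₁ (isAt x))) conserved ,
              λ {z} {y} p → ↭.trans (↭-sym (q₁ (isAt z))) (↭.trans (q₂ (isAt z) (away p))
              (↭-reflexive (sym (trans (q₃ (isAt y) refl) (at-cong (dropV-tracks p) (lookup (R ++ joinEnds x I)) c₂)))))

  kleinFlow⇔ : KleinFlow es ⇔ KleinFlow (edges (suppress G x))
  kleinFlow⇔ = mk⇔ to from
    where
    to : KleinFlow es → KleinFlow (edges (suppress G x))
    to (c , conserved) = let d , matches = push c (conserved x) in d , λ y →
      let z , p = dropV-surjective x y in conserved-↭ (↭-sym (matches p)) (conserved z)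
    from : KleinFlow (edges (suppress G x)) → KleinFlow es
    from (d , conserved) = c , local
      where
      c = proj₁ (pull d)
      local : ∀ z → Conserved (lookup es) c (isAt z)
      local z with x ≟ z
      ... | yes refl = proj₁ (proj₂ (pull d))
      ... | no x≢z     = conserved-↭ (proj₂ (proj₂ (pull d)) (dropV-just x≢z)) (conserved _)

  -- `pull` accepts every labelling, whereas `push` asks for conservation at `x`; hence the degrees
  -- are compared by pulling back a constant labelling.
  degree-suppress : ∀ {z y} → dropV x z ≡ just y → degree (suppress G x) y ≡ degree G z
  degree-suppress {z} {y} p = let c , _ , matches = pull (const 0F) in
    trans (sym (length-at (suppress G x) (const 0F) y)) (trans (sym (↭ₚ.↭-length (matches p))) (length-at G c z))

-- Suppressing both ends of a deleted edge in a cubic graph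

module Smooth (G : Graph) (cubic : ∀ x → degree G x ≡ 3) (e : Edge G) (u v : Fin (n G)) (u≢v : u ≢ v)
              (joins : Joins G e u v) where

  open DeleteEdge G e u v u≢v joins

  G₁ G₂ : Graph
  G₁ = deleteEdge G e
  G₂ = suppress G₁ u

  v′ : Fin (n G₂)
  v′ = punchOut′ u≢v

  module S₁ = Suppress G₁ u (suc-injectiveℕ (trans (sym degree-u) (cubic u)))
  -- The first suppression keeps the degree of `v` at 2, even if both remaining edges at `u` lead to
  -- `v`; the new edge is then a loop at `v′`.
  module S₂ = Suppress G₂ v′
    (trans (S₁.degree-suppress (dropV-just u≢v)) (suc-injectiveℕ (trans (sym degree-v) (cubic v))))

  smooth-degree : ∀ y → degree (smooth G e u v u≢v) y ≡ 3
  smooth-degree y with dropV-surjective v′ y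
  ... | z , p with dropV-surjective u z
  ...   | x , q = trans (S₂.degree-suppress p) (trans (S₁.degree-suppress q)
                  (trans (degree-off x (≢-sym (dropV-≢ q)) x≢v) (cubic x)))
    where
    x≢v : x ≢ v
    x≢v refl = dropV-≢ p (just-injective (trans (sym (dropV-just u≢v)) q))

  smooth⇔ : KleinFlow (edges G₁) ⇔ ThreeEdgeColourable (smooth G e u v u≢v)
  smooth⇔ = ⇔.trans S₁.kleinFlow⇔ (⇔.trans S₂.kleinFlow⇔
              (⇔.sym (threeEdgeColourable⇔kleinFlow (smooth G e u v u≢v) smooth-degree)))

-- Reducing the statements to flows conserved away from `u` and `v`

All-lookup⁻ : {X : Set} {P : X → Set} (xs : List X) → (∀ i → P (lookup xs i)) → All P xs
All-lookup⁻ []       p = []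
All-lookup⁻ (x ∷ xs) p = p zero ∷ All-lookup⁻ xs (p ∘ suc)

theorem3 : (G : Graph) → Snark G → (u v : Fin (n G)) (u≢v : u ≢ v) →
    (ThreeEdgeColourable (removeTwo G u v u≢v) ⇔ NowhereZero4Flow (removeTwo G u v u≢v))
    × (ThreeEdgeColourable (removeTwo G u v u≢v) ⇔ NowhereZero4Flow (identify G u v u≢v))
    × ((e : Edge G) → Joins G e u v →
    (ThreeEdgeColourable (removeTwo G u v u≢v) ⇔ NowhereZero4Flow (deleteEdge G e))
    × (ThreeEdgeColourable (removeTwo G u v u≢v) ⇔ NowhereZero4Flow (contractEdge G e u v u≢v))
    × (ThreeEdgeColourable (removeTwo G u v u≢v) ⇔ ThreeEdgeColourable (smooth G e u v u≢v)))
theorem3 G (_ , (attached , cubic) , uncolourable) u v u≢v =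
    ⇔.trans colourable⇔ (⇔.sym (nowhereZero4Flow⇔kleinFlow (removeTwo G u v u≢v)))
  , ⇔.trans colourable⇔off (⇔.sym (identify⇔ (edges G) closed))
  , λ e joins →
    let open DeleteEdge G e u v u≢v joins
        closed′ = All.tail (↭ₚ.All-resp-↭ (removeAt-↭ (edges G) e) closed)
        -- The uncolourability of `G` enters here, to exclude a nonzero excess at `u`; the converse
        -- merely forgets conservation at `u` and `v`.
        delete⇔ = ⇔.trans (⇔.trans colourable⇔off off⇔) (mk⇔
          (off⇒kleinFlow closed′ (uncolourable ∘ Equivalence.from (threeEdgeColourable⇔kleinFlow G cubic)))
          (λ { (c , conserved) → c , λ x _ _ → conserved x }))
    in  ⇔.trans delete⇔ (⇔.sym (nowhereZero4Flow⇔kleinFlow (deleteEdge G e)))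
      , ⇔.trans (⇔.trans colourable⇔off off⇔) (⇔.sym (identify⇔ es′ closed′))
      , ⇔.trans delete⇔ (Smooth.smooth⇔ G cubic e u v u≢v joins)
  where
  colourable⇔ : ThreeEdgeColourable (removeTwo G u v u≢v) ⇔ KleinFlow (edges (removeTwo G u v u≢v))
  colourable⇔ = threeEdgeColourable⇔kleinFlow (removeTwo G u v u≢v) (removeTwo-degree G u v u≢v cubic)

  colourable⇔off : ThreeEdgeColourable (removeTwo G u v u≢v) ⇔ KleinFlowOff u v (edges G)
  colourable⇔off = ⇔.trans colourable⇔ (RemoveTwo.kleinFlow⇔ u v u≢v (edges G))

  attached≢ : ∀ e s → endOf G e s ≢ nothing
  attached≢ e s p with trans (sym p) (proj₂ (attached e s))
  ... | ()

  closed : All NoFreeEnd (edges G)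
  closed = All-lookup⁻ (edges G) λ e → attached≢ e false , attached≢ e true

  -- The edge list is left arbitrary to cover both G/{u,v} and G/e, the latter being the
  -- identification after the deletion of `e`.
  identify⇔ : (es : List (EdgeT (n G))) → All NoFreeEnd es →
              NowhereZero4Flow (identify (graph (n G) es) u v u≢v) ⇔ KleinFlowOff u v es
  identify⇔ es closed = ⇔.trans (nowhereZero4Flow⇔kleinFlow (identify (graph (n G) es) u v u≢v)) (mk⇔
    (Identify.kleinFlow⇒off u v u≢v es)
    (λ flow → Identify.off⇒kleinFlow u v u≢v es flow (conserved-at₂ u v u≢v es closed flow)))
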